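{- Let $(K,\mathcal{L})$ be a $C$-minimal valued field, $W$ a definable set, and $f\colon X\subseteq W\times K\rightarrow K^\times$ a definable family of functions defined at a neighborhood of infinity. Then there is a definable family of functions $h\colon Y\subseteq W\times \Gamma_K\to \Gamma_K$ such that for all $w\in W$, $f_w$ factorizes at infinity over $\Gamma$ through $h_{w}$.
   Context: Valued fields $(K,v)$ are non-trivially valued; $\Gamma_K$ is the value group. Closed balls are $B(a,\gamma)=\{x\in K: v(x-a)\geq\gamma\}$ for $a \in K$, $\gamma\in\Gamma_K\cup\{+\infty\}$; open balls are $B^\circ(a,\gamma)=\{x\in K: v(x-a)>\gamma\}$ for $a\in K$, $\gamma\in\Gamma_K\cup\{ -\infty\}$ (so points are closed balls and $K$ is an open ball). A ball is a closed or an open ball. $\mathcal{L}_{div}=(+,-,\cdot,0,1,\mathrm{div})$ is the language of valued fields, with $\mathrm{div}(x,y)$ interpreted as $v(x)\leq v(y)$. Let $K$ be an algebraically closed valued field and $(K,\mathcal{L})$ an expansion of $(K,\mathcal{L}_{div})$ ($\mathcal{L}\supseteq\mathcal{L}_{div}$). $(K,\mathcal{L})$ is $C$-minimal (a "$C$-minimal valued field") if for every structure $(K',\mathcal{L})$ elementarily equivalent to it, every $\mathcal{L}$-definable subset of $K'$ is a boolean combination of balls. "Definable" means $\mathcal{L}$-definable with parameters; for subsets of (products involving) $\Gamma_K$ it means interpretable. A definable family $X\subseteq W\times K$ is a definable set whose projection to $W$ is all of $W$; $X_w=\{x: (w,x)\in X\}$. A definable family of functions is a definable function $f\colon X\subseteq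 W\times K\to K$, with fibers $f_w\colon X_w\to K$, $f_w(x)=f(w,x)$; similarly with $\Gamma_K$ in place of $K$. A neighborhood of infinity is a set of the form $K\setminus B(0,\gamma)$ with $\gamma\in\Gamma_K$. The family $f$ is defined at a neighborhood of infinity if for every $w\in W$ the set $X_w$ contains a neighborhood of infinity (which may depend on $w$). A function $g\colon Z\subseteq K\to K$ defined at a neighborhood of infinity factorizes at infinity over $\Gamma$ through a (possibly partial) function $h\colon\Gamma_K\to\Gamma_K$ if there is $\gamma_0\in\Gamma_K$ such that $v(g(x))=h(v(x))$ for all $x\in Z\setminus B(0,\gamma_0)$. -}

module Defs where

open import Level using (Level; suc)
open import Algebra.Bundles using (AbelianGroup; CommutativeRing)
open import Algebra.Definitions using (Invertible)
open import Data.Empty.Polymorphic using (⊥)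
open import Data.Fin.Base using (Fin)
open import Data.Fin.Patterns using (0F; 1F)
open import Data.List.Base using (List; []; _∷_; length)
open import Data.Nat.Base as ℕ using (ℕ)
open import Data.Product.Base using (Σ-syntax; ∃-syntax; _×_; _,_)
open import Data.Sum.Base using (_⊎_; inj₁; inj₂)
open import Data.Unit.Polymorphic using (⊤)
open import Data.Vec.Functional as Vector using (Vector)
open import Function.Bundles using (_⇔_)
open import Relation.Binary.Bundles using (Setoid)
open import Relation.Binary.Structures using (IsTotalOrder)
import Relation.Binary.Construct.Add.Supremum.Equality as AddSupremumEquality
import Relation.Binary.Construct.Add.Supremum.NonStrict as AddSupremumNonStrict
import Relation.Binary.Construct.NonStrictToStrict as NonStrictToStrict
open import Relation.Nullary.Construct.Add.Infimum using (_₋; ⊥₋)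
open import Relation.Nullary.Construct.Add.Supremum using (_⁺; ⊤⁺; [_])
open import Relation.Nullary.Negation.Core using (¬_)
open import Relation.Unary using (Pred; _∈_; _∉_; _≐_)

record Language (ℓ : Level) : Set (suc ℓ) where
  field
    Fun : ℕ → Set ℓ
    Rel : ℕ → Set ℓ

module _ {ℓ : Level} (𝓛 : Language ℓ) where
  open Language 𝓛

  data Term (n : ℕ) : Set ℓ where
    var : Fin n → Term n
    fun : ∀ {k} → Fun k → Vector (Term n) k → Term n

  infix  7 _≈ᶠ_
  infixr 6 _∧_
  infixr 5 _∨_
  infixr 4 _⇒_

  -- The free variables are de Bruijn indices below n; quantifiers bind
  -- index 0.
  data Formula (n : ℕ) : Set ℓ where
    _≈ᶠ_        : Term n → Term n → Formula n
    rel         : ∀ {k} → Rel k → Vector (Term n) k → Formula n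
    false       : Formula n
    _∧_ _∨_ _⇒_ : Formula n → Formula n → Formula n
    all ex      : Formula (ℕ.suc n) → Formula n

  Sentence : Set ℓ
  Sentence = Formula 0

  record Structure : Set (suc ℓ) where
    field
      setoid : Setoid ℓ ℓ
    open Setoid setoid public using (Carrier; _≈_)
    field
      ⟦_⟧ᶠ      : ∀ {k} → Fun k → Vector Carrier k → Carrier
      ⟦_⟧ᶠ-cong : ∀ {k} (f : Fun k) {xs ys : Vector Carrier k} →
                  (∀ i → xs i ≈ ys i) → ⟦ f ⟧ᶠ xs ≈ ⟦ f ⟧ᶠ ys
      ⟦_⟧ʳ      : ∀ {k} → Rel k → Vector Carrier k → Set ℓ
      ⟦_⟧ʳ-resp : ∀ {k} (r : Rel k) {xs ys : Vector Carrier k} →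
                  (∀ i → xs i ≈ ys i) → ⟦ r ⟧ʳ xs → ⟦ r ⟧ʳ ys

module _ {ℓ : Level} {𝓛 : Language ℓ} where

  eval : ∀ (M : Structure 𝓛) {n} → Term 𝓛 n →
         Vector (Structure.Carrier M) n → Structure.Carrier M
  eval M (var i)    ρ = ρ i
  eval M (fun f ts) ρ = Structure.⟦_⟧ᶠ M f (λ i → eval M (ts i) ρ)

  infix 3 _⊨_⟨_⟩

  _⊨_⟨_⟩ : ∀ (M : Structure 𝓛) {n} → Formula 𝓛 n →
           Vector (Structure.Carrier M) n → Set ℓ
  M ⊨ t ≈ᶠ u   ⟨ ρ ⟩ = Structure._≈_ M (eval M t ρ) (eval M u ρ)
  M ⊨ rel r ts ⟨ ρ ⟩ = Structure.⟦_⟧ʳ M r (λ i → eval M (ts i) ρ)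
  M ⊨ false    ⟨ ρ ⟩ = ⊥
  M ⊨ φ ∧ ψ    ⟨ ρ ⟩ = (M ⊨ φ ⟨ ρ ⟩) × (M ⊨ ψ ⟨ ρ ⟩)
  M ⊨ φ ∨ ψ    ⟨ ρ ⟩ = (M ⊨ φ ⟨ ρ ⟩) ⊎ (M ⊨ ψ ⟨ ρ ⟩)
  M ⊨ φ ⇒ ψ    ⟨ ρ ⟩ = (M ⊨ φ ⟨ ρ ⟩) → (M ⊨ ψ ⟨ ρ ⟩)
  M ⊨ all φ    ⟨ ρ ⟩ = ∀ a → M ⊨ φ ⟨ a Vector.∷ ρ ⟩
  M ⊨ ex φ     ⟨ ρ ⟩ = ∃[ a ] (M ⊨ φ ⟨ a Vector.∷ ρ ⟩)

  ElementarilyEquivalent : Structure 𝓛 → Structure 𝓛 → Set ℓ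
  ElementarilyEquivalent M N =
    (σ : Sentence 𝓛) → (M ⊨ σ ⟨ Vector.[] ⟩) ⇔ (N ⊨ σ ⟨ Vector.[] ⟩)

record OrderedAbelianGroup (ℓ : Level) : Set (suc ℓ) where
  field
    abelianGroup : AbelianGroup ℓ ℓ
  open AbelianGroup abelianGroup public
  infix 4 _≤_
  field
    _≤_          : Carrier → Carrier → Set ℓ
    isTotalOrder : IsTotalOrder _≈_ _≤_
    ∙-monoʳ-≤    : ∀ γ {δ ε} → δ ≤ ε → γ ∙ δ ≤ γ ∙ ε

  open AddSupremumEquality _≈_ public
    using (_≈⁺_; ⊤⁺≈⊤⁺; ≈⁺-isEquivalence) renaming ([_] to [_]≈)
  open AddSupremumNonStrict _≤_ public
    using (_≤⁺_; _≤⊤⁺; ≤⁺-isTotalOrder) renaming ([_] to [_]≤)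
  open NonStrictToStrict _≈⁺_ _≤⁺_ public
    using () renaming (_<_ to _<⁺_)

  infixl 6 _∙⁺_
  _∙⁺_ : Carrier ⁺ → Carrier ⁺ → Carrier ⁺
  [ γ ] ∙⁺ [ δ ] = [ γ ∙ δ ]
  [ γ ] ∙⁺ ⊤⁺    = ⊤⁺
  ⊤⁺    ∙⁺ _     = ⊤⁺

record ValuedField (ℓ : Level) : Set (suc ℓ) where
  field
    commutativeRing : CommutativeRing ℓ ℓ
    valueGroup      : OrderedAbelianGroup ℓ
  open CommutativeRing commutativeRing public
  module Γ = OrderedAbelianGroup valueGroup
  open Γ public using (_≈⁺_; _≤⁺_; _<⁺_; _∙⁺_)

  -- Fields are classical: Algebra.Apartness would make the apartness
  -- relation part of the structure.
  field
    1≉0        : 1# ≉ 0#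
    invertible : ∀ {x} → x ≉ 0# → Invertible _≈_ 1# _*_ x

    v            : Carrier → Γ.Carrier ⁺
    v-cong       : ∀ {x y} → x ≈ y → v x ≈⁺ v y
    v≈∞⇔≈0       : ∀ x → (v x ≈⁺ ⊤⁺) ⇔ (x ≈ 0#)
    v-*          : ∀ x y → v (x * y) ≈⁺ v x ∙⁺ v y
    -- v (x + y) ≥ min (v x) (v y)
    v-+          : ∀ x y → (v x ≤⁺ v (x + y)) ⊎ (v y ≤⁺ v (x + y))
    v-surjective : ∀ γ → ∃[ x ] (v x ≈⁺ [ γ ])
    nontrivial   : ∃[ γ ] ¬ (γ Γ.≈ Γ.ε)

  -- The value of the polynomial Σᵢ aᵢ Xⁱ at x.
  evalPoly : ∀ {n} → Vector Carrier n → Carrier → Carrier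
  evalPoly a x = Vector.foldr (λ c r → c + x * r) 0# a

  IsAlgebraicallyClosed : Set ℓ
  IsAlgebraicallyClosed =
    ∀ n (a : Vector Carrier (2 ℕ.+ n)) → Vector.last a ≉ 0# →
    ∃[ x ] (evalPoly a x ≈ 0#)

  closedBall : Carrier → Γ.Carrier ⁺ → Pred Carrier ℓ
  closedBall a γ x = γ ≤⁺ v (x - a)

  openBall : Carrier → Γ.Carrier ₋ → Pred Carrier ℓ
  openBall a ⊥₋    x = ⊤
  openBall a [ γ ] x = [ γ ] <⁺ v (x - a)

  data BooleanCombination : Set ℓ where
    closed : Carrier → Γ.Carrier ⁺ → BooleanCombination
    open′  : Carrier → Γ.Carrier ₋ → BooleanCombination
    ∁      : BooleanCombination → BooleanCombination
    _∩_    : BooleanCombination → BooleanCombination → BooleanCombination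
    _∪_    : BooleanCombination → BooleanCombination → BooleanCombination

  ⟦_⟧ᵇ : BooleanCombination → Pred Carrier ℓ
  ⟦ closed a γ ⟧ᵇ   = closedBall a γ
  ⟦ open′ a γ ⟧ᵇ    = openBall a γ
  ⟦ ∁ b ⟧ᵇ        x = x ∉ ⟦ b ⟧ᵇ
  ⟦ b ∩ c ⟧ᵇ      x = x ∈ ⟦ b ⟧ᵇ × x ∈ ⟦ c ⟧ᵇ
  ⟦ b ∪ c ⟧ᵇ      x = x ∈ ⟦ b ⟧ᵇ ⊎ x ∈ ⟦ c ⟧ᵇ

  IsBooleanCombinationOfBalls : Pred Carrier ℓ → Set ℓ
  IsBooleanCombinationOfBalls D = ∃[ b ] (D ≐ ⟦ b ⟧ᵇ)

data DivFun : ℕ → Set where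
  plus times : DivFun 2
  neg        : DivFun 1
  zero one   : DivFun 0

data DivRel : ℕ → Set where
  div : DivRel 2

-- A language containing the language of valued fields is given by its
-- additional symbols.
𝓛div⊎ : ∀ {ℓ} → Language ℓ → Language ℓ
𝓛div⊎ 𝓔 = record
  { Fun = λ k → DivFun k ⊎ Language.Fun 𝓔 k
  ; Rel = λ k → DivRel k ⊎ Language.Rel 𝓔 k
  }

record ExpandedValuedField {ℓ} (𝓔 : Language ℓ) : Set (suc ℓ) where
  open Language 𝓔
  field
    valuedField : ValuedField ℓ
  open ValuedField valuedField public
  field
    extraFun      : ∀ {k} → Fun k → Vector Carrier k → Carrier
    extraFun-cong : ∀ {k} (f : Fun k) {xs ys : Vector Carrier k} →
                    (∀ i → xs i ≈ ys i) → extraFun f xs ≈ extraFun f ys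
    extraRel      : ∀ {k} → Rel k → Vector Carrier k → Set ℓ
    extraRel-resp : ∀ {k} (r : Rel k) {xs ys : Vector Carrier k} →
                    (∀ i → xs i ≈ ys i) → extraRel r xs → extraRel r ys

  structure : Structure (𝓛div⊎ 𝓔)
  structure = record
    { setoid    = setoid
    ; ⟦_⟧ᶠ      = funs
    ; ⟦_⟧ᶠ-cong = funs-cong
    ; ⟦_⟧ʳ      = rels
    ; ⟦_⟧ʳ-resp = rels-resp
    }
    where
    funs : ∀ {k} → DivFun k ⊎ Fun k → Vector Carrier k → Carrier
    funs (inj₁ plus)  xs = xs 0F + xs 1F
    funs (inj₁ times) xs = xs 0F * xs 1F
    funs (inj₁ neg)   xs = - xs 0F
    funs (inj₁ zero)  xs = 0#
    funs (inj₁ one)   xs = 1#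
    funs (inj₂ f)     xs = extraFun f xs

    funs-cong : ∀ {k} (f : DivFun k ⊎ Fun k) {xs ys : Vector Carrier k} →
                (∀ i → xs i ≈ ys i) → funs f xs ≈ funs f ys
    funs-cong (inj₁ plus)  eq = +-cong (eq 0F) (eq 1F)
    funs-cong (inj₁ times) eq = *-cong (eq 0F) (eq 1F)
    funs-cong (inj₁ neg)   eq = -‿cong (eq 0F)
    funs-cong (inj₁ zero)  eq = refl
    funs-cong (inj₁ one)   eq = refl
    funs-cong (inj₂ f)     eq = extraFun-cong f eq

    rels : ∀ {k} → DivRel k ⊎ Rel k → Vector Carrier k → Set ℓ
    rels (inj₁ div) xs = v (xs 0F) ≤⁺ v (xs 1F)
    rels (inj₂ r)   xs = extraRel r xs

    module ≤⁺ = IsTotalOrder (Γ.≤⁺-isTotalOrder Γ.isTotalOrder)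

    rels-resp : ∀ {k} (r : DivRel k ⊎ Rel k) {xs ys : Vector Carrier k} →
                (∀ i → xs i ≈ ys i) → rels r xs → rels r ys
    rels-resp (inj₁ div) eq p =
      ≤⁺.≤-respʳ-≈ (v-cong (eq 1F)) (≤⁺.≤-respˡ-≈ (v-cong (eq 0F)) p)
    rels-resp (inj₂ r)   eq p = extraRel-resp r eq p

data Sort : Set where
  𝕂 𝚪 : Sort

module _ {ℓ : Level} {𝓔 : Language ℓ} (K : ExpandedValuedField 𝓔) where
  open ExpandedValuedField K

  sortSetoid : Sort → Setoid ℓ ℓ
  sortSetoid 𝕂 = setoid
  sortSetoid 𝚪 = Γ.setoid

  ⟦_⟧ˢ : Sort → Set ℓ
  ⟦ σ ⟧ˢ = Setoid.Carrier (sortSetoid σ)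

  -- Points of the product of the listed copies of K and of the value
  -- group.
  Point : List Sort → Set ℓ
  Point []      = ⊤
  Point (σ ∷ s) = ⟦ σ ⟧ˢ × Point s

  RepresentsCoordinate : ∀ σ → Carrier → ⟦ σ ⟧ˢ → Set ℓ
  RepresentsCoordinate 𝕂 x a = x ≈ a
  RepresentsCoordinate 𝚪 x γ = v x ≈⁺ [ γ ]

  Represents : ∀ s → Vector Carrier (length s) → Point s → Set ℓ
  Represents []      _ _       = ⊤
  Represents (σ ∷ s) x (a , w) =
    RepresentsCoordinate σ (Vector.head x) a × Represents s (Vector.tail x) w

  -- D is definable with parameters, in the interpretable sense as soon
  -- as the value group is involved: its preimage under the maps
  -- v : K^× → Γ, taken in the coordinates of sort 𝚪, is defined by a
  -- formula.  In particular a definable D respects the setoid equalities.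
  IsDefinable : ∀ s → Pred (Point s) ℓ → Set ℓ
  IsDefinable s D =
    ∃[ p ] Σ[ φ ∈ Formula (𝓛div⊎ 𝓔) (length s ℕ.+ p) ]
    Σ[ b ∈ Vector Carrier p ]
      (∀ x w → Represents s x w →
        (w ∈ D) ⇔ (structure ⊨ φ ⟨ x Vector.++ b ⟩))

  record DefinableSet (s : List Sort) : Set (suc ℓ) where
    field
      member      : Pred (Point s) ℓ
      isDefinable : IsDefinable s member

-- It suffices that K′ ranges over expansions of valued fields: a structure
-- elementarily equivalent to K is one, with value group the quotient of
-- its nonzero elements by the equivalence relation that div induces.
record IsCMinimalValuedField {ℓ} {𝓔 : Language ℓ}
                             (K : ExpandedValuedField 𝓔) : Set (suc ℓ) where
  field
    isAlgebraicallyClosed :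
      ExpandedValuedField.IsAlgebraicallyClosed K
    isCMinimal :
      ∀ (K′ : ExpandedValuedField 𝓔) →
      ElementarilyEquivalent (ExpandedValuedField.structure K)
                             (ExpandedValuedField.structure K′) →
      ∀ (D : Pred (ExpandedValuedField.Carrier K′) ℓ) →
      IsDefinable K′ (𝕂 ∷ []) (λ (x , _) → D x) →
      ExpandedValuedField.IsBooleanCombinationOfBalls K′ D

record PartialFunction {ℓ} (A B : Setoid ℓ ℓ) : Set (suc ℓ) where
  private
    module A = Setoid A
    module B = Setoid B
  field
    Dom      : Pred A.Carrier ℓ
    Dom-resp : ∀ {x y} → x A.≈ y → x ∈ Dom → y ∈ Dom
    fn       : ∀ x → x ∈ Dom → B.Carrier
    fn-cong  : ∀ {x y} → x A.≈ y → (p : x ∈ Dom) (q : y ∈ Dom) →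
               fn x p B.≈ fn y q

module _ {ℓ : Level} {𝓔 : Language ℓ} (K : ExpandedValuedField 𝓔) where
  open ExpandedValuedField K
  open DefinableSet

  -- Definable functions X ⊆ W × σ → σ.  Compatibility with equality of
  -- the points of W follows from the definability of the graph.
  record DefinableFamilyOfFunctions {s} (W : DefinableSet K s) (σ : Sort) :
                                    Set (suc ℓ) where
    open Setoid (sortSetoid K σ) using () renaming (_≈_ to _≈ˢ_)
    field
      fibre : Point K s → PartialFunction (sortSetoid K σ) (sortSetoid K σ)

    X : Point K s → Pred (⟦_⟧ˢ K σ) ℓ
    X w = PartialFunction.Dom (fibre w)

    f : ∀ w x → x ∈ X w → ⟦_⟧ˢ K σ
    f w = PartialFunction.fn (fibre w)

    field
      X⊆W×σ             : ∀ {w x} → x ∈ X w → w ∈ member W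
      projection        : ∀ {w} → w ∈ member W → ∃[ x ] (x ∈ X w)
      domainIsDefinable : IsDefinable K (σ ∷ s) (λ (x , w) → x ∈ X w)
      graphIsDefinable  : IsDefinable K (σ ∷ σ ∷ s)
                            (λ (y , x , w) → Σ[ p ∈ x ∈ X w ] (f w x p ≈ˢ y))

  ContainsNeighborhoodOfInfinity : Pred Carrier ℓ → Set ℓ
  ContainsNeighborhoodOfInfinity Z =
    ∃[ γ ] (∀ x → x ∉ closedBall 0# [ γ ] → x ∈ Z)

  IsDefinedAtInfinity : ∀ {s} {W : DefinableSet K s} →
                        DefinableFamilyOfFunctions W 𝕂 → Set ℓ
  IsDefinedAtInfinity {W = W} F =
    ∀ w → w ∈ member W →
    ContainsNeighborhoodOfInfinity (DefinableFamilyOfFunctions.X F w)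

  -- The equation v (g x) = h (v x) entails that v x lies in the domain
  -- of h.
  FactorizesAtInfinity : PartialFunction setoid setoid →
                         PartialFunction Γ.setoid Γ.setoid → Set ℓ
  FactorizesAtInfinity g h =
    ∃[ γ₀ ] (∀ x (x∈Z : x ∈ g.Dom) → x ∉ closedBall 0# [ γ₀ ] →
      ∃[ γ ] Σ[ γ∈Y ∈ (γ ∈ h.Dom) ]
        (v x ≈⁺ [ γ ]) × (v (g.fn x x∈Z) ≈⁺ [ h.fn γ γ∈Y ]))
    where
    module g = PartialFunction g
    module h = PartialFunction h

{-# OPTIONS --safe #-}
module Submission where

-- Call the sets { x : v x = γ } circles.  A definable subset of K is a
-- boolean combination of balls, so it contains all but finitely many
-- residue classes of a given circle or meets only finitely many of them.
-- Put g = v ∘ f_w.  On each circle g takes some value δ on all but finitely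
-- many residue classes: otherwise infinitely many distinct suprema (or
-- infima) of g over single residue classes arise, but the set T of these
-- endpoints is a definable subset of the dense order Γ_K, and the finite or
-- cofinite dichotomy for the classes lying below t shows that T contains no
-- interval around any t; so T is finite.  That g x is the generic value of
-- g on the circle of x is a definable condition on x which holds somewhere
-- on every circle, hence holds throughout a neighbourhood of infinity, where
-- g is thus constant on circles.

open import Level using (Level)
open import Axiom.ExcludedMiddle using (ExcludedMiddle)
import Algebra.Properties.AbelianGroup as AbelianGroupProperties
import Algebra.Properties.CommutativeSemigroup as CommutativeSemigroupProperties
import Algebra.Properties.Group as GroupProperties
import Algebra.Properties.Ring as RingProperties
open import Data.Empty using (⊥)
import Data.Empty.Polymorphic as Polymorphic
open import Data.Fin.Base using (Fin; zero; suc; splitAt; _↑ˡ_; _↑ʳ_)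
open import Data.Fin.Patterns using (0F; 1F; 2F; 3F)
open import Data.List.Base using (List; []; _∷_; _++_; map; length; cartesianProductWith)
open import Data.List.Membership.Propositional using (find)
open import Data.List.Membership.Propositional.Properties using (∈-cartesianProductWith⁺)
open import Data.List.Relation.Unary.All as All using (All; []; _∷_)
import Data.List.Relation.Unary.All.Properties as All
open import Data.List.Relation.Unary.Any as Any using (Any; here; there)
import Data.List.Relation.Unary.Any.Properties as Any
open import Data.Nat.Base as ℕ using (ℕ)
open import Data.Product.Base using (Σ-syntax; ∃-syntax; _×_; _,_; proj₁; proj₂)
open import Data.Product.Function.NonDependent.Propositional using (_×-⇔_)
open import Data.Sum.Base using (_⊎_; inj₁; inj₂; [_,_]′)
open import Data.Sum.Function.Propositional using (_⊎-⇔_)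
open import Data.Unit.Polymorphic using (tt)
open import Data.Vec.Functional as Vector using (Vector)
import Data.Vec.Functional.Properties as Vector
open import Function.Base using (id; _∘_)
open import Function.Bundles using (_⇔_; Equivalence; mk⇔)
open import Function.Construct.Composition using (_⇔-∘_)
open import Function.Construct.Symmetry using (⇔-sym)
open import Relation.Binary.Bundles using (Setoid)
open import Relation.Binary.PropositionalEquality.Core as ≡ using (_≡_)
open import Relation.Binary.Structures using (IsTotalOrder)
import Relation.Nullary.Construct.Add.Infimum as Inf
open import Relation.Nullary.Construct.Add.Supremum using (⊤⁺; [_])
open import Relation.Nullary.Decidable using (Dec; yes; no; decidable-stable)
open import Relation.Nullary.Negation.Core using (¬_; contradiction)
open import Relation.Unary using (_∈_)
open import Defs

-- The preorder of values, and how balls meet circles.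

module ValuationPreorder {ℓ : Level} (em : ExcludedMiddle ℓ) (K : ValuedField ℓ) where
  open ValuedField K
  open Equivalence using (to; from)
  open RingProperties ring using (-1*x≈-x; -0#≈0#)
  open GroupProperties +-group
    using (⁻¹-involutive; ⁻¹-anti-homo-//; \\-leftDividesʳ; //-rightDividesˡ)
  open import Relation.Binary.Reasoning.Setoid setoid
  module ≤⁺ = IsTotalOrder (Γ.≤⁺-isTotalOrder Γ.isTotalOrder)

  ¬¬-elim : {P : Set ℓ} → ¬ ¬ P → P
  ¬¬-elim = decidable-stable em

  infix 4 _≼_ _≺_ _~_

  -- The value group is handled through representatives: x ≼ y stands
  -- for v x ≤ v y.
  _≼_ _≺_ _~_ : Carrier → Carrier → Set ℓ
  x ≼ y = v x ≤⁺ v y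
  x ≺ y = ¬ (y ≼ x)
  x ~ y = (x ≼ y) × (y ≼ x)

  ≼-trans : ∀ {x y z} → x ≼ y → y ≼ z → x ≼ z
  ≼-trans = ≤⁺.trans

  ≼-total : ∀ x y → x ≼ y ⊎ y ≼ x
  ≼-total x y = ≤⁺.total (v x) (v y)

  ≼-reflexive : ∀ {x y} → x ≈ y → x ≼ y
  ≼-reflexive eq = ≤⁺.reflexive (v-cong eq)

  ≼-refl : ∀ {x} → x ≼ x
  ≼-refl = ≼-reflexive refl

  ~-refl : ∀ {x} → x ~ x
  ~-refl = ≼-refl , ≼-refl

  ~-sym : ∀ {x y} → x ~ y → y ~ x
  ~-sym (p , q) = q , p

  ~-trans : ∀ {x y z} → x ~ y → y ~ z → x ~ z
  ~-trans (p , q) (p′ , q′) = ≼-trans p p′ , ≼-trans q′ q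

  ≈⇒~ : ∀ {x y} → x ≈ y → x ~ y
  ≈⇒~ eq = ≼-reflexive eq , ≼-reflexive (sym eq)

  v⇒~ : ∀ {x y} → v x ≈⁺ v y → x ~ y
  v⇒~ eq = ≤⁺.reflexive eq , ≤⁺.reflexive (≤⁺.Eq.sym eq)

  ~⇒v : ∀ {x y} → x ~ y → v x ≈⁺ v y
  ~⇒v (p , q) = ≤⁺.antisym p q

  ≺⇒≼ : ∀ {x y} → x ≺ y → x ≼ y
  ≺⇒≼ {x} {y} p = [ (λ q → q) , (λ q → contradiction q p) ]′ (≼-total x y)

  ≺-irrefl : ∀ {x} → ¬ (x ≺ x)
  ≺-irrefl p = p ≼-refl

  ≼-≺-trans : ∀ {x y z} → x ≼ y → y ≺ z → x ≺ z
  ≼-≺-trans p q r = q (≼-trans r p)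

  ≺-≼-trans : ∀ {x y z} → x ≺ y → y ≼ z → x ≺ z
  ≺-≼-trans p q r = p (≼-trans q r)

  ≼-or-≻ : ∀ x y → x ≼ y ⊎ y ≺ x
  ≼-or-≻ x y with em {P = x ≼ y}
  ... | yes p = inj₁ p
  ... | no p  = inj₂ p

  ≼0 : ∀ x → x ≼ 0#
  ≼0 x = ≤⁺.trans (v x Γ.≤⊤⁺)
    (≤⁺.reflexive (≤⁺.Eq.sym (from (v≈∞⇔≈0 0#) refl)))

  0≼⇒≈0 : ∀ {x} → 0# ≼ x → x ≈ 0#
  0≼⇒≈0 {x} p = to (v≈∞⇔≈0 x)
    (≤⁺.antisym (v x Γ.≤⊤⁺)
      (≤⁺.trans (≤⁺.reflexive (≤⁺.Eq.sym (from (v≈∞⇔≈0 0#) refl))) p))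

  ≉0⇒≺0 : ∀ {x} → x ≉ 0# → x ≺ 0#
  ≉0⇒≺0 x≉0 p = x≉0 (0≼⇒≈0 p)

  ≺⇒≉0 : ∀ {x y} → x ≺ y → x ≉ 0#
  ≺⇒≉0 {x} {y} p x≈0 = p (≼-trans (≼0 y) (≼-reflexive (sym x≈0)))

  ≼-≉0 : ∀ {x y} → x ≼ y → y ≉ 0# → x ≉ 0#
  ≼-≉0 p y≉0 x≈0 = y≉0 (0≼⇒≈0 (≼-trans (≼-reflexive (sym x≈0)) p))

  *-monoʳ-≼ : ∀ z {x y} → x ≼ y → z * x ≼ z * y
  *-monoʳ-≼ z {x} {y} p =
    ≤⁺.trans (≤⁺.reflexive (v-* z x))
      (≤⁺.trans (∙⁺-mono (v z) p) (≤⁺.reflexive (≤⁺.Eq.sym (v-* z y))))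
    where
    ∙⁺-mono : ∀ γ {δ ε} → δ ≤⁺ ε → γ ∙⁺ δ ≤⁺ γ ∙⁺ ε
    ∙⁺-mono [ γ ] Γ.[ p ]≤   = Γ.[ Γ.∙-monoʳ-≤ γ p ]≤
    ∙⁺-mono [ γ ] (_ Γ.≤⊤⁺) = _ Γ.≤⊤⁺
    ∙⁺-mono ⊤⁺    _          = ⊤⁺ Γ.≤⊤⁺

  *-mono-≼ : ∀ {x y z w} → x ≼ y → z ≼ w → x * z ≼ y * w
  *-mono-≼ {x} {y} {z} {w} p q =
    ≼-trans (*-monoʳ-≼ x q)
      (≼-trans (≼-reflexive (*-comm x w))
        (≼-trans (*-monoʳ-≼ w p) (≼-reflexive (*-comm w y))))

  *-cancelˡ-≼ : ∀ {z x y} → z ≉ 0# → z * x ≼ z * y → x ≼ y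
  *-cancelˡ-≼ {z} {x} {y} z≉0 p with invertible z≉0
  ... | i , i*z≈1 , _ =
    ≼-trans (≼-reflexive (sym (cancel x)))
      (≼-trans (*-monoʳ-≼ i p) (≼-reflexive (cancel y)))
    where
    cancel : ∀ u → i * (z * u) ≈ u
    cancel u = begin
      i * (z * u) ≈⟨ *-assoc i z u ⟨
      i * z * u   ≈⟨ *-congʳ i*z≈1 ⟩
      1# * u      ≈⟨ *-identityˡ u ⟩
      u           ∎

  *-monoʳ-≺ : ∀ {z x y} → z ≉ 0# → x ≺ y → z * x ≺ z * y
  *-monoʳ-≺ z≉0 p q = p (*-cancelˡ-≼ z≉0 q)

  -1*-1≈1 : - 1# * - 1# ≈ 1#
  -1*-1≈1 = trans (-1*x≈-x (- 1#)) (⁻¹-involutive 1#)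

  -- Multiplying an inequality between 1 and -1 by -1 reverses it, because (-1)(-1) = 1.
  -1~1 : - 1# ~ 1#
  -1~1 with ≼-total (- 1#) 1#
  ... | inj₁ p = p , ≼-trans (≼-reflexive (sym -1*-1≈1))
                       (≼-trans (*-monoʳ-≼ (- 1#) p) (≼-reflexive (*-identityʳ _)))
  ... | inj₂ p = ≼-trans (≼-reflexive (sym (*-identityʳ _)))
                   (≼-trans (*-monoʳ-≼ (- 1#) p) (≼-reflexive -1*-1≈1)) , p

  -‿~ : ∀ x → - x ~ x
  -‿~ x = ≼-trans (≼-reflexive eq) (≼-trans (*-monoʳ-≼ x (proj₁ -1~1)) (≼-reflexive (*-identityʳ x)))
        , ≼-trans (≼-reflexive (sym (*-identityʳ x))) (≼-trans (*-monoʳ-≼ x (proj₂ -1~1)) (≼-reflexive (sym eq)))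
    where
    eq : - x ≈ x * - 1#
    eq = trans (sym (-1*x≈-x x)) (*-comm (- 1#) x)

  +-≼ : ∀ {z x y} → z ≼ x → z ≼ y → z ≼ x + y
  +-≼ {z} {x} {y} p q = [ ≼-trans p , ≼-trans q ]′ (v-+ x y)

  +-≺ : ∀ {z x y} → z ≺ x → z ≺ y → z ≺ x + y
  +-≺ {z} {x} {y} p q = [ ≺-≼-trans p , ≺-≼-trans q ]′ (v-+ x y)

  minus-swap : ∀ x y → x - y ~ y - x
  minus-swap x y = ~-trans (~-sym (-‿~ (x - y))) (≈⇒~ (⁻¹-anti-homo-// x y))

  minus-telescope : ∀ x y z → (x - y) + (y - z) ≈ x - z
  minus-telescope x y z = begin
    (x - y) + (y - z)   ≈⟨ +-assoc x (- y) (y - z) ⟩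
    x + (- y + (y - z)) ≈⟨ +-congˡ (\\-leftDividesʳ y (- z)) ⟩
    x - z               ∎

  minus-+ : ∀ x y → (x - y) + y ≈ x
  minus-+ x y = //-rightDividesˡ y x

  minus-0 : ∀ x → x - 0# ≈ x
  minus-0 x = trans (+-congˡ -0#≈0#) (+-identityʳ x)

  minus-≼ : ∀ {z x y} → z ≼ x → z ≼ y → z ≼ x - y
  minus-≼ {y = y} p q = +-≼ p (≼-trans q (proj₂ (-‿~ y)))

  minus-trans-≺ : ∀ {r x y z} → r ≺ x - y → r ≺ y - z → r ≺ x - z
  minus-trans-≺ {r} {x} {y} {z} p q =
    ≺-≼-trans (+-≺ p q) (≼-reflexive (minus-telescope x y z))

  minus-sym-≺ : ∀ {r x y} → r ≺ x - y → r ≺ y - x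
  minus-sym-≺ {x = x} {y} p = ≺-≼-trans p (proj₁ (minus-swap x y))

  -- If x - y had a value greater than v x, so would x = (x - y) + y.
  minus-≺ˡ : ∀ {x y} → x ≺ y → x - y ~ x
  minus-≺ˡ {x} {y} x≺y =
    ¬¬-elim (λ p → +-≺ p x≺y (≼-reflexive (minus-+ x y))) , minus-≼ ≼-refl (≺⇒≼ x≺y)

  minus-≺ʳ : ∀ {x y} → y ≺ x → x - y ~ y
  minus-≺ʳ {x} {y} y≺x = ~-trans (minus-swap x y) (minus-≺ˡ y≺x)

  [≈]-injective : ∀ {γ δ} → [ γ ] ≈⁺ [ δ ] → γ Γ.≈ δ
  [≈]-injective Γ.[ eq ]≈ = eq

  finite-value : ∀ {x} → x ≉ 0# → ∃[ γ ] (v x ≈⁺ [ γ ])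
  finite-value {x} x≉0 = finite (v x) (λ p → x≉0 (to (v≈∞⇔≈0 x) p))
    where
    finite : ∀ γ → ¬ (γ ≈⁺ ⊤⁺) → ∃[ δ ] (γ ≈⁺ [ δ ])
    finite [ γ ] _ = γ , ≤⁺.Eq.refl
    finite ⊤⁺    p = contradiction Γ.⊤⁺≈⊤⁺ p

  v1≈ε : v 1# ≈⁺ [ Γ.ε ]
  v1≈ε = idempotent (v 1#) (λ p → 1≉0 (to (v≈∞⇔≈0 1#) p))
    (≤⁺.Eq.trans (≤⁺.Eq.sym (v-* 1# 1#)) (v-cong (*-identityˡ 1#)))
    where
    open GroupProperties Γ.group using () renaming (identityˡ-unique to Γ-identityˡ-unique)
    idempotent : ∀ γ → ¬ (γ ≈⁺ ⊤⁺) → γ ∙⁺ γ ≈⁺ γ → γ ≈⁺ [ Γ.ε ]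
    idempotent [ γ ] _ Γ.[ p ]≈ = Γ.[ Γ-identityˡ-unique γ γ p ]≈
    idempotent ⊤⁺    p _        = contradiction Γ.⊤⁺≈⊤⁺ p

  -- An element of nontrivial value serves, or else its inverse.
  value-above-1 : ∃[ e ] (1# ≺ e × e ≉ 0#)
  value-above-1 with nontrivial
  ... | γ , γ≉ε with v-surjective γ
  ...   | x , vx≈γ = choose (≼-or-≻ x 1#) (≼-or-≻ 1# x)
    where
    x≉0 : x ≉ 0#
    x≉0 x≈0 = finite (≤⁺.Eq.trans (≤⁺.Eq.sym vx≈γ) (from (v≈∞⇔≈0 x) x≈0))
      where
      finite : ∀ {γ} → ¬ ([ γ ] ≈⁺ ⊤⁺)
      finite ()

    choose : x ≼ 1# ⊎ 1# ≺ x → 1# ≼ x ⊎ x ≺ 1# → ∃[ e ] (1# ≺ e × e ≉ 0#)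
    choose (inj₂ 1≺x) _ = x , 1≺x , x≉0
    choose (inj₁ _) (inj₂ x≺1) with invertible x≉0
    ... | i , i*x≈1 , x*i≈1 = i , 1≺i , i≉0
      where
      1≺i : 1# ≺ i
      1≺i i≼1 = x≺1 (≼-trans (≼-reflexive (sym x*i≈1))
        (≼-trans (*-monoʳ-≼ x i≼1) (≼-reflexive (*-identityʳ x))))
      i≉0 : i ≉ 0#
      i≉0 i≈0 = 1≉0 (trans (sym i*x≈1) (trans (*-congʳ i≈0) (zeroˡ x)))
    choose (inj₁ x≼1) (inj₁ 1≼x) = contradiction
      ([≈]-injective (≤⁺.Eq.trans (≤⁺.Eq.sym vx≈γ) (≤⁺.Eq.trans (~⇒v (x≼1 , 1≼x)) v1≈ε))) γ≉ε

  *-≉0 : ∀ {x y} → x ≉ 0# → y ≉ 0# → x * y ≉ 0#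
  *-≉0 {x} {y} x≉0 y≉0 xy≈0 = y≉0 (0≼⇒≈0
    (*-cancelˡ-≼ x≉0 (≼-trans (≼0 _) (≼-reflexive (sym xy≈0)))))

  above : ∀ {x} → x ≉ 0# → ∃[ y ] (x ≺ y × y ≉ 0#)
  above {x} x≉0 with value-above-1
  ... | e , 1≺e , e≉0 =
    x * e , ≼-≺-trans (≼-reflexive (sym (*-identityʳ x))) (*-monoʳ-≺ x≉0 1≺e) , *-≉0 x≉0 e≉0

  below : ∀ {x} → x ≉ 0# → ∃[ y ] (y ≺ x)
  below {x} x≉0 with value-above-1
  ... | e , 1≺e , e≉0 with invertible e≉0
  ...   | i , i*e≈1 , e*i≈1 =
    x * i , ≺-≼-trans (*-monoʳ-≺ x≉0 i≺1) (≼-reflexive (*-identityʳ x))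
    where
    i≺1 : i ≺ 1#
    i≺1 1≼i = 1≺e (≼-trans (≼-reflexive (sym (*-identityʳ e)))
      (≼-trans (*-monoʳ-≼ e 1≼i) (≼-reflexive e*i≈1)))

  lower-bound : ∀ L → ∃[ r ] (r ≉ 0# × All (r ≼_) L)
  lower-bound [] = 1# , 1≉0 , []
  lower-bound (l ∷ L) with lower-bound L
  ... | r , r≉0 , r≼L with ≼-or-≻ r l
  ...   | inj₁ r≼l = r , r≉0 , r≼l ∷ r≼L
  ...   | inj₂ l≺r = l , ≺⇒≉0 l≺r , ≼-refl ∷ All.map (≼-trans (≺⇒≼ l≺r)) r≼L

  -- The residue classes of the circle { y : v y = v r } are the balls
  -- { y : v (y − a) > v r }; Avoids r L y says that y lies in none of
  -- those given by the centres a in L.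
  Avoids : Carrier → List Carrier → Carrier → Set ℓ
  Avoids r L y = All (λ a → y - a ≼ r) L

  avoids-residue-class : ∀ {r L x y} → r ≺ x - y → Avoids r L x → Avoids r L y
  avoids-residue-class p = All.map λ q → ¬¬-elim λ q′ → minus-trans-≺ p q′ q

  ¬avoids⇒residue-class : ∀ {r L x} → ¬ Avoids r L x → Any (λ a → r ≺ x - a) L
  ¬avoids⇒residue-class {r} {L} {x} = All.¬All⇒Any¬ (λ a → em) L

  -- A value of `y` above v r would pass to x = (x - y) + y; a value below v r would also be the
  -- value of x - y.
  residue-class-~ : ∀ {r x y} → x ~ r → r ≺ x - y → y ~ r
  residue-class-~ {r} {x} {y} (x≼r , r≼x) p = ¬¬-elim (λ r≺y →
      +-≺ p r≺y (≼-trans (≼-reflexive (minus-+ x y)) x≼r))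
    , ¬¬-elim (λ y≺r → ≺-irrefl (≺-≼-trans p
      (≼-trans (proj₁ (minus-≺ʳ (≺-≼-trans y≺r r≼x))) (≺⇒≼ y≺r))))

  -- A pair (a , c) stands for the two balls with centre a and radius v c.
  Alike : Carrier → Carrier → Carrier × Carrier → Set ℓ
  Alike x y (a , c) = (c ≼ x - a ⇔ c ≼ y - a) × (x - a ≼ c ⇔ y - a ≼ c)

  radius : ∀ γ → ∃[ c ] (v c ≈⁺ γ)
  radius [ γ ] = v-surjective γ
  radius ⊤⁺    = 0# , from (v≈∞⇔≈0 0#) refl

  -- The list collects centre and radius of every ball that occurs. Closed balls use the first half
  -- of `Alike`, open balls the negation of the second; the radius ∞ is represented by 0.
  balls : ∀ b → ∃[ P ] (∀ {x y} → All (Alike x y) P → ⟦ b ⟧ᵇ x ⇔ ⟦ b ⟧ᵇ y)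
  balls (closed a γ) with radius γ
  ... | c , vc≈γ = (a , c) ∷ [] , λ q → let alike = proj₁ (All.head q) in
    mk⇔ (λ p → ≤⁺.trans γ≤vc (to alike (≤⁺.trans vc≤γ p)))
        (λ p → ≤⁺.trans γ≤vc (from alike (≤⁺.trans vc≤γ p)))
    where
    γ≤vc = ≤⁺.reflexive (≤⁺.Eq.sym vc≈γ)
    vc≤γ = ≤⁺.reflexive vc≈γ
  balls (open′ a Inf.⊥₋) = [] , λ _ → mk⇔ (λ p → p) (λ p → p)
  balls (open′ a Inf.[ γ ]) with v-surjective γ
  ... | c , vc≈γ = (a , c) ∷ [] , λ q → let alike = proj₂ (All.head q) in
    mk⇔ (λ p → in-ball (λ q → out-of-ball p (from alike q)))
        (λ p → in-ball (λ q → out-of-ball p (to alike q)))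
    where
    γ≤vc = ≤⁺.reflexive (≤⁺.Eq.sym vc≈γ)
    in-ball : ∀ {x} → c ≺ x - a → [ γ ] <⁺ v (x - a)
    in-ball p = ≤⁺.trans γ≤vc (≺⇒≼ p) ,
      λ eq → p (≤⁺.trans (≤⁺.reflexive (≤⁺.Eq.sym eq)) γ≤vc)
    out-of-ball : ∀ {x} → [ γ ] <⁺ v (x - a) → c ≺ x - a
    out-of-ball (p , γ≉) q = γ≉ (≤⁺.antisym p (≤⁺.trans q (≤⁺.reflexive vc≈γ)))
  balls (∁ b) with balls b
  ... | P , alike = P , λ q → mk⇔ (λ p p′ → p (from (alike q) p′)) (λ p p′ → p (to (alike q) p′))
  balls (b ∩ c) with balls b | balls c
  ... | P , alike | P′ , alike′ = P ++ P′ , λ q →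
    alike (All.++⁻ˡ P q) ×-⇔ alike′ (All.++⁻ʳ P q)
  balls (b ∪ c) with balls b | balls c
  ... | P , alike | P′ , alike′ = P ++ P′ , λ q →
    alike (All.++⁻ˡ P q) ⊎-⇔ alike′ (All.++⁻ʳ P q)

  -- The points of the circle outside the residue classes of the centres are
  -- all at the same distance from each centre.
  constant-on-circle : ∀ r b → ∃[ L ] (∀ {x y} → x ~ r → y ~ r →
    Avoids r L x → Avoids r L y → ⟦ b ⟧ᵇ x → ⟦ b ⟧ᵇ y)
  constant-on-circle r b with balls b
  ... | P , alike = map proj₁ P , λ x~r y~r avx avy →
    to (alike (All.zipWith (λ (p , q) → alike-at x~r y~r p q) (All.map⁻ avx , All.map⁻ avy)))
    where
    distance : ∀ {x} a → x ~ r → x - a ≼ r → (a ≺ r → x - a ~ a) × (r ≼ a → x - a ~ r)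
    -- A centre of value below v r has distance v a from the whole circle; any other has distance v
    -- r from the points outside its residue class.
    distance a (x≼r , r≼x) p = (λ a≺r → minus-≺ʳ (≺-≼-trans a≺r r≼x)) , (λ r≼a → p , minus-≼ r≼x r≼a)
    equidistant : ∀ {x y} a → x ~ r → y ~ r → x - a ≼ r → y - a ≼ r → x - a ~ y - a
    equidistant a x~r y~r p q with ≼-or-≻ r a
    ... | inj₁ r≼a = ~-trans (proj₂ (distance a x~r p) r≼a) (~-sym (proj₂ (distance a y~r q) r≼a))
    ... | inj₂ a≺r = ~-trans (proj₁ (distance a x~r p) a≺r) (~-sym (proj₁ (distance a y~r q) a≺r))
    alike-at : ∀ {x y p} → x ~ r → y ~ r → x - proj₁ p ≼ r → y - proj₁ p ≼ r → Alike x y p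
    alike-at {p = a , c} x~r y~r p q with equidistant a x~r y~r p q
    ... | d , d′ = mk⇔ (λ e → ≼-trans e d) (λ e → ≼-trans e d′)
                 , mk⇔ (λ e → ≼-trans d′ e) (λ e → ≼-trans d e)

  Between : Carrier → Carrier → Carrier → Set ℓ
  Between x y l = (x ≼ l) × (l ≼ y)

  -- If no centre a has its value in [v x, v y], then x - a and y - a either both have value v a or
  -- have the values v x and v y. In the second case only a radius with value in [v x, v y] can
  -- separate them.
  thresholds : ∀ b → ∃[ L ] (∀ {x y} → x ≼ y → All (λ l → ¬ Between x y l) L →
    ⟦ b ⟧ᵇ x ⇔ ⟦ b ⟧ᵇ y)
  thresholds b with balls b
  ... | P , alike = map proj₁ P ++ map proj₂ P , λ x≼y gap →
    alike (All.zipWith (λ {p} (q , q′) → alike-at p x≼y q q′)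
      (All.map⁻ (All.++⁻ˡ (map proj₁ P) gap) , All.map⁻ (All.++⁻ʳ (map proj₁ P) gap)))
    where
    alike-at : ∀ {x y} p → x ≼ y → ¬ Between x y (proj₁ p) → ¬ Between x y (proj₂ p) →
               Alike x y p
    alike-at {x} {y} (a , c) x≼y ∉a ∉c with ≼-or-≻ x a
    ... | inj₂ a≺x with minus-≺ʳ a≺x | minus-≺ʳ (≺-≼-trans a≺x x≼y)
    ...   | d , d′ | e , e′ =
      mk⇔ (λ q → ≼-trans q (≼-trans d e′)) (λ q → ≼-trans q (≼-trans e d′)) ,
      mk⇔ (λ q → ≼-trans e (≼-trans d′ q)) (λ q → ≼-trans d (≼-trans e′ q))
    alike-at {x} {y} (a , c) x≼y ∉a ∉c | inj₁ x≼a
      with minus-≺ˡ (≼-≺-trans x≼y y≺a) | minus-≺ˡ y≺a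
      where
      y≺a : y ≺ a
      y≺a a≼y = ∉a (x≼a , a≼y)
    ... | d , d′ | e , e′ =
      mk⇔ (λ q → ≼-trans (≼-trans q d) (≼-trans x≼y e′))
          (λ q → ≼-trans (c≼x (≼-trans q e)) d′) ,
      mk⇔ (λ q → ≼-trans e (y≼c (≼-trans d′ q)))
          (λ q → ≼-trans d (≼-trans x≼y (≼-trans e′ q)))
      where
      c≼x : c ≼ y → c ≼ x
      c≼x c≼y = ¬¬-elim λ x≺c → ∉c (≺⇒≼ x≺c , c≼y)
      y≼c : x ≼ c → y ≼ c
      y≼c x≼c = ¬¬-elim λ c≺y → ∉c (x≼c , ≺⇒≼ c≺y)

-- Algebraic closedness: dense value group and infinite residue field.

module AlgebraicallyClosed {ℓ : Level} (em : ExcludedMiddle ℓ) (K : ValuedField ℓ)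
  (polynomial-root : ValuedField.IsAlgebraicallyClosed K) where
  open ValuedField K hiding (zero)
  open ValuationPreorder em K
  open Equivalence using (to; from)
  open RingProperties ring using (-‿distribˡ-*; -‿distribʳ-*)
  open CommutativeSemigroupProperties *-commutativeSemigroup using (x∙yz≈y∙xz)
  open GroupProperties +-group using (⁻¹-involutive; inverseʳ-unique)
  open import Relation.Binary.Reasoning.Setoid setoid

  square-root : ∀ c → ∃[ x ] (x * x ≈ c)
  square-root c with polynomial-root 1 (- c Vector.∷ 0# Vector.∷ 1# Vector.∷ Vector.[]) 1≉0
  ... | x , eq = x , (begin
    x * x                            ≈⟨ *-congˡ simplify ⟨
    x * (0# + x * (1# + x * 0#))     ≈⟨ inverseʳ-unique _ _ eq ⟩
    - - c                            ≈⟨ ⁻¹-involutive c ⟩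
    c                                ∎)
    where
    simplify : 0# + x * (1# + x * 0#) ≈ x
    simplify = begin
      0# + x * (1# + x * 0#) ≈⟨ +-identityˡ _ ⟩
      x * (1# + x * 0#)      ≈⟨ *-congˡ (+-congˡ (zeroʳ x)) ⟩
      x * (1# + 0#)          ≈⟨ *-congˡ (+-identityʳ 1#) ⟩
      x * 1#                 ≈⟨ *-identityʳ x ⟩
      x                      ∎

  -- A square root of x y has the mean of the two values. If `y` is 0, of value ∞, any finite value
  -- above v x serves instead.
  ≺-dense : ∀ {x y} → x ≺ y → ∃[ m ] (x ≺ m × m ≺ y)
  ≺-dense {x} {y} x≺y with em {P = y ≈ 0#}
  ... | yes y≈0 with above (≺⇒≉0 x≺y)
  ...   | m , x≺m , m≉0 = m , x≺m , ≺-≼-trans (≉0⇒≺0 m≉0) (≼-reflexive (sym y≈0))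
  ≺-dense {x} {y} x≺y | no y≉0 with square-root (x * y)
  ... | m , m²≈xy = m
    , (λ m≼x → x≺y (*-cancelˡ-≼ (≺⇒≉0 x≺y)
        (≼-trans (≼-reflexive (sym m²≈xy)) (*-mono-≼ m≼x m≼x))))
    , (λ y≼m → x≺y (*-cancelˡ-≼ y≉0
        (≼-trans (*-mono-≼ y≼m y≼m) (≼-reflexive (trans m²≈xy (*-comm x y))))))

  infix 4 _∈[_,_⟩ _∈⟨_,_]

  _∈[_,_⟩ _∈⟨_,_] : Carrier → Carrier → Carrier → Set ℓ
  l ∈[ x , y ⟩ = (x ≼ l) × (l ≺ y)
  l ∈⟨ x , y ] = (x ≺ l) × (l ≼ y)

  -- By density the lower end `s` can be moved past each member of `L` below `t`.
  gap-below : ∀ {t} → t ≉ 0# → ∀ L → ∃[ s ] (s ≺ t × All (λ l → ¬ (l ∈[ s , t ⟩)) L)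
  gap-below t≉0 [] with below t≉0
  ... | s , s≺t = s , s≺t , []
  gap-below {t} t≉0 (l ∷ L) with gap-below t≉0 L | em {P = l ≺ t}
  ... | s , s≺t , gap | no l⊀t = s , s≺t , (λ (_ , l≺t) → l⊀t l≺t) ∷ gap
  ... | s , s≺t , gap | yes l≺t with ≼-or-≻ s l
  ...   | inj₂ l≺s = s , s≺t , (λ (s≼l , _) → l≺s s≼l) ∷ gap
  ...   | inj₁ s≼l with ≺-dense l≺t
  ...     | m , l≺m , m≺t = m , m≺t , (λ (m≼l , _) → l≺m m≼l)
            ∷ All.map (λ ∉ (m≼k , k≺t) → ∉ (≼-trans s≼l (≼-trans (≺⇒≼ l≺m) m≼k) , k≺t)) gap

  gap-above : ∀ {t} → t ≉ 0# → ∀ L → ∃[ s ] (t ≺ s × All (λ l → ¬ (l ∈⟨ t , s ])) L)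
  gap-above t≉0 [] with above t≉0
  ... | s , t≺s , _ = s , t≺s , []
  gap-above {t} t≉0 (l ∷ L) with gap-above t≉0 L | em {P = t ≺ l}
  ... | s , t≺s , gap | no t⊀l = s , t≺s , (λ (t≺l , _) → t⊀l t≺l) ∷ gap
  ... | s , t≺s , gap | yes t≺l with ≼-or-≻ l s
  ...   | inj₂ s≺l = s , t≺s , (λ (_ , l≼s) → s≺l l≼s) ∷ gap
  ...   | inj₁ l≼s with ≺-dense t≺l
  ...     | m , t≺m , m≺l = m , t≺m , (λ (_ , l≼m) → m≺l l≼m)
            ∷ All.map (λ ∉ (t≺k , k≼m) → ∉ (t≺k , ≼-trans k≼m (≼-trans (≺⇒≼ m≺l) l≼s))) gap

  -- The coefficients of c + (X − a) p.
  mulAdd : ∀ {n} → Carrier → Carrier → Vector Carrier n → Vector Carrier (ℕ.suc n)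
  mulAdd {ℕ.zero}  a c p = c Vector.∷ Vector.[]
  mulAdd {ℕ.suc n} a c p =
    (c - a * Vector.head p) Vector.∷ mulAdd a (Vector.head p) (Vector.tail p)

  evalPoly-mulAdd : ∀ {n} a c (p : Vector Carrier n) x →
                    evalPoly (mulAdd a c p) x ≈ c + (x - a) * evalPoly p x
  evalPoly-mulAdd {ℕ.zero}  a c p x = +-congˡ (trans (zeroʳ x) (sym (zeroʳ (x - a))))
  evalPoly-mulAdd {ℕ.suc n} a c p x = begin
    (c - a * p₀) + x * evalPoly (mulAdd a p₀ (Vector.tail p)) x
      ≈⟨ +-congˡ (*-congˡ (evalPoly-mulAdd a p₀ (Vector.tail p) x)) ⟩
    (c - a * p₀) + x * (p₀ + (x - a) * E)
      ≈⟨ +-assoc c _ _ ⟩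
    c + (- (a * p₀) + x * (p₀ + (x - a) * E))
      ≈⟨ +-congˡ (+-congˡ (distribˡ x p₀ _)) ⟩
    c + (- (a * p₀) + (x * p₀ + x * ((x - a) * E)))
      ≈⟨ +-congˡ (sym (+-assoc _ _ _)) ⟩
    c + ((- (a * p₀) + x * p₀) + x * ((x - a) * E))
      ≈⟨ +-congˡ (+-cong (trans (+-comm _ _) (+-congˡ (-‿distribˡ-* a p₀))) (x∙yz≈y∙xz x (x - a) E)) ⟩
    c + ((x * p₀ + - a * p₀) + (x - a) * (x * E))
      ≈⟨ +-congˡ (+-congʳ (sym (distribʳ p₀ x (- a)))) ⟩
    c + ((x - a) * p₀ + (x - a) * (x * E))
      ≈⟨ +-congˡ (sym (distribˡ (x - a) p₀ (x * E))) ⟩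
    c + (x - a) * (p₀ + x * E) ∎
    where
    p₀ = Vector.head p
    E = evalPoly (Vector.tail p) x

  last-mulAdd : ∀ {n} a c (p : Vector Carrier (ℕ.suc n)) →
                Vector.last (mulAdd a c p) ≈ Vector.last p
  last-mulAdd {ℕ.zero}  a c p = refl
  last-mulAdd {ℕ.suc n} a c p = last-mulAdd a (Vector.head p) (Vector.tail p)

  ∏-minus : List Carrier → Carrier → Carrier
  ∏-minus []      x = 1#
  ∏-minus (a ∷ L) x = (x - a) * ∏-minus L x

  ∏-minus-coefficients : ∀ L → Σ[ p ∈ Vector Carrier (ℕ.suc (length L)) ]
    (Vector.last p ≈ 1# × (∀ x → evalPoly p x ≈ ∏-minus L x))
  ∏-minus-coefficients [] = 1# Vector.∷ Vector.[] , refl ,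
    λ x → trans (+-congˡ (zeroʳ x)) (+-identityʳ 1#)
  ∏-minus-coefficients (a ∷ L) with ∏-minus-coefficients L
  ... | p , monic , eval-p = mulAdd a 0# p , trans (last-mulAdd a 0# p) monic ,
    λ x → trans (evalPoly-mulAdd a 0# p x) (trans (+-identityˡ _) (*-congˡ (eval-p x)))

  -- The coefficient -1 in `mulAdd` turns the product into (X - a) ∏ (X - aᵢ) - 1, which is still
  -- monic; the factor X - a makes its degree positive.
  ∏-minus-attains-1 : ∀ a L → ∃[ x ] (∏-minus (a ∷ L) x ≈ 1#)
  ∏-minus-attains-1 a L with ∏-minus-coefficients L
  ... | p , monic , eval-p with polynomial-root (length L) (mulAdd a (- 1#) p)
          (λ eq → 1≉0 (trans (sym monic) (trans (sym (last-mulAdd a (- 1#) p)) eq)))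
  ...   | x , eq = x , (begin
    (x - a) * ∏-minus L x  ≈⟨ *-congˡ (eval-p x) ⟨
    (x - a) * evalPoly p x ≈⟨ inverseʳ-unique _ _ (trans (sym (evalPoly-mulAdd a (- 1#) p x)) eq) ⟩
    - - 1#                 ≈⟨ ⁻¹-involutive 1# ⟩
    1#                     ∎)

  ∏-minus-≼1 : ∀ {L x} → All (λ a → x - a ≼ 1#) L → ∏-minus L x ≼ 1#
  ∏-minus-≼1 []       = ≼-refl
  ∏-minus-≼1 (p ∷ ps) = ≼-trans (*-mono-≼ p (∏-minus-≼1 ps)) (≼-reflexive (*-identityˡ 1#))

  1≼∏-minus : ∀ {L x} → All (λ a → 1# ≼ x - a) L → 1# ≼ ∏-minus L x
  1≼∏-minus []       = ≼-refl
  1≼∏-minus (p ∷ ps) = ≼-trans (≼-reflexive (sym (*-identityˡ 1#))) (*-mono-≼ p (1≼∏-minus ps))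

  -- The cofactor of each factor has nonnegative value, so the value of the factor is at most that
  -- of the product.
  factors-≼1 : ∀ {L x} → All (λ a → 1# ≼ x - a) L → ∏-minus L x ≼ 1# → All (λ a → x - a ≼ 1#) L
  factors-≼1 []       _ = []
  factors-≼1 {a ∷ L} {x} (p ∷ ps) q =
    ≼-trans (≼-trans (≼-reflexive (sym (*-identityʳ _))) (*-monoʳ-≼ (x - a) (1≼∏-minus ps))) q
    ∷ factors-≼1 ps (≼-trans (≼-trans (≼-reflexive (sym (*-identityˡ _))) (*-mono-≼ p ≼-refl)) q)

  opaque
    -- By a root x of X ∏ (X − a) − 1: if v x < 0 then every factor has value
    -- v x, so all the factors have nonnegative values, and these add up to 0.
    avoid-integral : ∀ L → All (1# ≼_) L → ∃[ x ] (x ~ 1# × Avoids 1# L x)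
    avoid-integral L 1≼L with ∏-minus-attains-1 0# L
    ... | x , eq = x , (head≼1 , 1≼x) , All.tail all≼1
      where
      1≼x : 1# ≼ x
      1≼x = ¬¬-elim λ x≺1 → ≺-irrefl (≺-≼-trans
        (≼-≺-trans (≼-trans (≼-reflexive (*-congʳ (minus-0 x)))
            (*-monoʳ-≼ x (∏-minus-≼1 (All.map
              (λ 1≼a → ≼-trans (proj₁ (minus-≺ˡ (≺-≼-trans x≺1 1≼a))) (≺⇒≼ x≺1)) 1≼L))))
          (≼-≺-trans (≼-reflexive (*-identityʳ x)) x≺1))
        (≼-reflexive (sym eq)))
      all≼1 : Avoids 1# (0# ∷ L) x
      all≼1 = factors-≼1 (≼-trans 1≼x (≼-reflexive (sym (minus-0 x)))
        ∷ All.map (λ 1≼a → minus-≼ 1≼x 1≼a) 1≼L) (≼-reflexive eq)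
      head≼1 : x ≼ 1#
      head≼1 = ≼-trans (≼-reflexive (sym (minus-0 x))) (All.head all≼1)

  opaque
    avoid-1 : ∀ L → ∃[ x ] (x ~ 1# × Avoids 1# L x)
    avoid-1 L with integral L
      where
      integral : ∀ L → ∃[ L′ ] (All (1# ≼_) L′ ×
        (∀ x → x ~ 1# → Avoids 1# L′ x → Avoids 1# L x))
      integral [] = [] , [] , λ _ _ _ → []
      integral (a ∷ L) with integral L | ≼-or-≻ 1# a
      ... | L′ , ps , f | inj₁ p = a ∷ L′ , p ∷ ps , λ x x~1 qs → All.head qs ∷ f x x~1 (All.tail qs)
      ... | L′ , ps , f | inj₂ p = L′ , ps , λ x x~1 qs →
        ≼-trans (proj₁ (minus-≺ʳ (≺-≼-trans p (proj₂ x~1)))) (≺⇒≼ p) ∷ f x x~1 qs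
    ... | L′ , ps , f with avoid-integral L′ ps
    ...   | x , x~1 , qs = x , x~1 , f x x~1 qs

  opaque
    -- Multiplication by `r` carries the residue classes of the circle of 1 to those of the circle
    -- of `r`. This is the form in which the infinitude of the residue field is used.
    avoid : ∀ {r} → r ≉ 0# → ∀ L → ∃[ x ] (x ~ r × Avoids r L x)
    avoid {r} r≉0 L with invertible r≉0
    ... | i , i*r≈1 , r*i≈1 with avoid-1 (map (i *_) L)
    ...   | x , x~1 , av = r * x , scale x~1 , All.map step (All.map⁻ av)
      where
      r*1 : r * 1# ≈ r
      r*1 = *-identityʳ r
      scale : ∀ {x} → x ~ 1# → r * x ~ r
      scale (p , q) = ≼-trans (*-monoʳ-≼ r p) (≼-reflexive r*1)
                    , ≼-trans (≼-reflexive (sym r*1)) (*-monoʳ-≼ r q)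
      step : ∀ {a} → x - i * a ≼ 1# → r * x - a ≼ r
      step {a} p = ≼-trans (≼-reflexive (begin
          r * x - a                 ≈⟨ +-congˡ (-‿cong (begin
            r * (i * a) ≈⟨ *-assoc r i a ⟨
            r * i * a   ≈⟨ *-congʳ r*i≈1 ⟩
            1# * a      ≈⟨ *-identityˡ a ⟩
            a           ∎)) ⟨
          r * x - r * (i * a)       ≈⟨ +-congˡ (-‿distribʳ-* r (i * a)) ⟩
          r * x + r * (- (i * a))   ≈⟨ distribˡ r x _ ⟨
          r * (x - i * a)           ∎))
        (≼-trans (*-monoʳ-≼ r p) (≼-reflexive r*1))

-- Renaming of variables in formulas.

module _ {ℓ : Level} {𝓛 : Language ℓ} where
  open Equivalence using (to; from)

  renameᵗ : ∀ {m n} → (Fin m → Fin n) → Term 𝓛 m → Term 𝓛 n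
  renameᵗ σ (var i)    = var (σ i)
  renameᵗ σ (fun f ts) = fun f (λ i → renameᵗ σ (ts i))

  lift : ∀ {m n} → (Fin m → Fin n) → Fin (ℕ.suc m) → Fin (ℕ.suc n)
  lift σ zero    = zero
  lift σ (suc i) = suc (σ i)

  rename : ∀ {m n} → (Fin m → Fin n) → Formula 𝓛 m → Formula 𝓛 n
  rename σ (t ≈ᶠ u)   = renameᵗ σ t ≈ᶠ renameᵗ σ u
  rename σ (rel r ts) = rel r (λ i → renameᵗ σ (ts i))
  rename σ false      = false
  rename σ (φ ∧ ψ)    = rename σ φ ∧ rename σ ψ
  rename σ (φ ∨ ψ)    = rename σ φ ∨ rename σ ψ
  rename σ (φ ⇒ ψ)    = rename σ φ ⇒ rename σ ψ
  rename σ (all φ)    = all (rename (lift σ) φ)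
  rename σ (ex φ)     = ex (rename (lift σ) φ)

  module _ (M : Structure 𝓛) where
    open Structure M
    open Setoid setoid using (refl; sym; trans)

    eval-rename : ∀ {m n} (t : Term 𝓛 m) (σ : Fin m → Fin n) {ρ ρ′} →
                  (∀ i → ρ (σ i) ≈ ρ′ i) → eval M (renameᵗ σ t) ρ ≈ eval M t ρ′
    eval-rename (var i)    σ eq = eq i
    eval-rename (fun f ts) σ eq = ⟦ f ⟧ᶠ-cong (λ i → eval-rename (ts i) σ eq)

    private
      lift-env : ∀ {m n} (σ : Fin m → Fin n) {ρ ρ′} → (∀ i → ρ (σ i) ≈ ρ′ i) →
                 ∀ a i → (a Vector.∷ ρ) (lift σ i) ≈ (a Vector.∷ ρ′) i
      lift-env σ eq a zero    = refl
      lift-env σ eq a (suc i) = eq i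

    -- Environments are compared pointwise up to `≈`, so even `rename id` has a use: it moves a
    -- formula between environments that merely agree pointwise.
    ⊨-rename : ∀ {m n} (φ : Formula 𝓛 m) (σ : Fin m → Fin n) {ρ ρ′} →
               (∀ i → ρ (σ i) ≈ ρ′ i) → (M ⊨ rename σ φ ⟨ ρ ⟩) ⇔ (M ⊨ φ ⟨ ρ′ ⟩)
    ⊨-rename (t ≈ᶠ u) σ eq = mk⇔
      (λ p → trans (sym (eval-rename t σ eq)) (trans p (eval-rename u σ eq)))
      (λ p → trans (eval-rename t σ eq) (trans p (sym (eval-rename u σ eq))))
    ⊨-rename (rel r ts) σ eq = mk⇔
      (⟦ r ⟧ʳ-resp (λ i → eval-rename (ts i) σ eq))
      (⟦ r ⟧ʳ-resp (λ i → sym (eval-rename (ts i) σ eq)))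
    ⊨-rename false σ eq = mk⇔ id id
    ⊨-rename (φ ∧ ψ) σ eq = ⊨-rename φ σ eq ×-⇔ ⊨-rename ψ σ eq
    ⊨-rename (φ ∨ ψ) σ eq = ⊨-rename φ σ eq ⊎-⇔ ⊨-rename ψ σ eq
    ⊨-rename (φ ⇒ ψ) σ eq = mk⇔
      (λ p q → to (⊨-rename ψ σ eq) (p (from (⊨-rename φ σ eq) q)))
      (λ p q → from (⊨-rename ψ σ eq) (p (to (⊨-rename φ σ eq) q)))
    ⊨-rename (all φ) σ eq = mk⇔
      (λ p a → to (⊨-rename φ (lift σ) (lift-env σ eq a)) (p a))
      (λ p a → from (⊨-rename φ (lift σ) (lift-env σ eq a)) (p a))
    ⊨-rename (ex φ) σ eq = mk⇔
      (λ (a , p) → a , to (⊨-rename φ (lift σ) (lift-env σ eq a)) p)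
      (λ (a , p) → a , from (⊨-rename φ (lift σ) (lift-env σ eq a)) p)

∷-++ : ∀ {a} {A : Set a} {m n} (x : A) (xs : Vector A m) (ys : Vector A n) i →
       (x Vector.∷ (xs Vector.++ ys)) i ≡ ((x Vector.∷ xs) Vector.++ ys) i
∷-++ x xs ys zero = ≡.refl
∷-++ {m = m} x xs ys (suc i) with splitAt m i
... | inj₁ j = ≡.refl
... | inj₂ j = ≡.refl

-- Closure properties of definable predicates.

module Definability {ℓ : Level} {𝓔 : Language ℓ} (K : ExpandedValuedField 𝓔)
  {q : ℕ} (b : Vector (ExpandedValuedField.Carrier K) q) where
  open ExpandedValuedField K hiding (zero)
  open Equivalence using (to; from)

  -- A formula is paired with its meaning, so that the combinators below assemble formulas alongside
  -- the predicates they define, over fixed parameters `b`.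
  Definable : ∀ n → (Vector Carrier n → Set ℓ) → Set ℓ
  Definable n P = Σ[ φ ∈ Formula (𝓛div⊎ 𝓔) (n ℕ.+ q) ]
    (∀ xs → P xs ⇔ (structure ⊨ φ ⟨ xs Vector.++ b ⟩))

  DefinableTerm : ∀ n → (Vector Carrier n → Carrier) → Set ℓ
  DefinableTerm n f = Σ[ t ∈ Term (𝓛div⊎ 𝓔) (n ℕ.+ q) ]
    (∀ xs → f xs ≈ eval structure t (xs Vector.++ b))

  varᵈ : ∀ {n} (i : Fin n) → DefinableTerm n (λ xs → xs i)
  varᵈ i = var (i ↑ˡ q) , λ xs → reflexive (≡.sym (Vector.lookup-++ˡ xs b i))

  infixl 8 _-ᵈ_
  _-ᵈ_ : ∀ {n f g} → DefinableTerm n f → DefinableTerm n g →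
         DefinableTerm n (λ xs → f xs - g xs)
  (t , p) -ᵈ (u , q) = fun (inj₁ plus) (t Vector.∷ fun (inj₁ neg) (u Vector.∷ Vector.[]) Vector.∷ Vector.[])
    , λ xs → +-cong (p xs) (-‿cong (q xs))

  oneᵈ : ∀ {n} → DefinableTerm n (λ _ → 1#)
  oneᵈ = fun (inj₁ one) Vector.[] , λ _ → refl

  infix 7 _≼ᵈ_
  _≼ᵈ_ : ∀ {n f g} → DefinableTerm n f → DefinableTerm n g →
         Definable n (λ xs → v (f xs) ≤⁺ v (g xs))
  _≼ᵈ_ {f = f} {g} (t , p) (u , q) =
    rel (inj₁ div) (t Vector.∷ u Vector.∷ Vector.[]) , λ xs →
    let values = f xs Vector.∷ g xs Vector.∷ Vector.[]
        terms i = eval structure ((t Vector.∷ u Vector.∷ Vector.[]) i) (xs Vector.++ b)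
        eq : ∀ i → values i ≈ terms i
        eq = λ { 0F → p xs ; 1F → q xs }
    in mk⇔ (⟦_⟧ʳ-resp (inj₁ div) {values} {terms} eq)
           (⟦_⟧ʳ-resp (inj₁ div) {terms} {values} (λ i → sym (eq i)))
    where open Structure structure using (⟦_⟧ʳ-resp)

  infixr 6 _×ᵈ_
  _×ᵈ_ : ∀ {n P Q} → Definable n P → Definable n Q → Definable n (λ xs → P xs × Q xs)
  (φ , p) ×ᵈ (ψ , q) = φ ∧ ψ , λ xs → p xs ×-⇔ q xs

  infixr 5 _⊎ᵈ_
  _⊎ᵈ_ : ∀ {n P Q} → Definable n P → Definable n Q → Definable n (λ xs → P xs ⊎ Q xs)
  (φ , p) ⊎ᵈ (ψ , q) = φ ∨ ψ , λ xs → p xs ⊎-⇔ q xs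

  infixr 4 _→ᵈ_
  _→ᵈ_ : ∀ {n P Q} → Definable n P → Definable n Q → Definable n (λ xs → P xs → Q xs)
  (φ , p) →ᵈ (ψ , q) = (φ ⇒ ψ) , λ xs → mk⇔
    (λ f x → to (q xs) (f (from (p xs) x)))
    (λ f x → from (q xs) (f (to (p xs) x)))

  ¬ᵈ_ : ∀ {n P} → Definable n P → Definable n (λ xs → ¬ P xs)
  ¬ᵈ (φ , p) = (φ ⇒ false) , λ xs → mk⇔
    (λ f x → contradiction (from (p xs) x) f)
    (λ f x → Polymorphic.⊥-elim (f (to (p xs) x)))

  private
    ⊨-∷-++ : ∀ {n} (φ : Formula (𝓛div⊎ 𝓔) (ℕ.suc n ℕ.+ q)) a (xs : Vector Carrier n) →
      (structure ⊨ rename id φ ⟨ a Vector.∷ (xs Vector.++ b) ⟩) ⇔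
      (structure ⊨ φ ⟨ (a Vector.∷ xs) Vector.++ b ⟩)
    ⊨-∷-++ φ a xs = ⊨-rename structure φ id (λ i → reflexive (∷-++ a xs b i))

  allᵛ : ∀ {n P} → Definable (ℕ.suc n) P → Definable n (λ xs → ∀ a → P (a Vector.∷ xs))
  allᵛ (φ , p) = all (rename id φ) , λ xs → mk⇔
    (λ f a → from (⊨-∷-++ φ a xs) (to (p (a Vector.∷ xs)) (f a)))
    (λ f a → from (p (a Vector.∷ xs)) (to (⊨-∷-++ φ a xs) (f a)))

  exᵛ : ∀ {n P} → Definable (ℕ.suc n) P → Definable n (λ xs → ∃[ a ] P (a Vector.∷ xs))
  exᵛ (φ , p) = ex (rename id φ) , λ xs → mk⇔
    (λ (a , x) → a , from (⊨-∷-++ φ a xs) (to (p (a Vector.∷ xs)) x))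
    (λ (a , x) → a , from (p (a Vector.∷ xs)) (to (⊨-∷-++ φ a xs) x))

  -- Variants of allᵛ and exᵛ whose P is found by unification.
  allᵈ : ∀ {n} {P : Vector Carrier n → Carrier → Set ℓ} →
         Definable (ℕ.suc n) (λ xs → P (Vector.tail xs) (Vector.head xs)) →
         Definable n (λ xs → ∀ a → P xs a)
  allᵈ = allᵛ

  exᵈ : ∀ {n} {P : Vector Carrier n → Carrier → Set ℓ} →
        Definable (ℕ.suc n) (λ xs → P (Vector.tail xs) (Vector.head xs)) →
        Definable n (λ xs → ∃[ a ] P xs a)
  exᵈ = exᵛ

  infixl 3 _≐ᵈ_
  _≐ᵈ_ : ∀ {n P Q} → Definable n P → (∀ xs → Q xs ⇔ P xs) → Definable n Q
  (φ , p) ≐ᵈ eq = φ , λ xs → p xs ⇔-∘ eq xs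

  reindex : ∀ {m n P} → Definable m P → (σ : Fin m → Fin n) → Definable n (λ xs → P (xs ∘ σ))
  reindex {m} {n} (φ , p) σ = rename σ′ φ , λ xs →
    ⇔-sym (⊨-rename structure φ σ′ (env xs)) ⇔-∘ p (xs ∘ σ)
    where
    σ′ : Fin (m ℕ.+ q) → Fin (n ℕ.+ q)
    σ′ i = [ (λ j → σ j ↑ˡ q) , (λ j → n ↑ʳ j) ]′ (splitAt m i)
    env : ∀ xs i → (xs Vector.++ b) (σ′ i) ≈ ((xs ∘ σ) Vector.++ b) i
    env xs i with splitAt m i
    ... | inj₁ j = reflexive (Vector.lookup-++ˡ xs b (σ j))
    ... | inj₂ j = reflexive (Vector.lookup-++ʳ xs b j)

  relationᵈ : ∀ (R : Carrier → Carrier → Set ℓ) → Definable 2 (λ xs → R (xs 0F) (xs 1F)) →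
              ∀ {n} (i j : Fin n) → Definable n (λ xs → R (xs i) (xs j))
  relationᵈ R d i j = reindex d (i Vector.∷ j Vector.∷ Vector.[])

  module _ (K-Cminimal : IsCMinimalValuedField K) where
    open IsCMinimalValuedField K-Cminimal

    -- C-minimality is applied to `K` as a structure elementarily equivalent to itself, with the
    -- coordinates `xs` added to the parameters.
    booleanCombination : ∀ {n P} → Definable (ℕ.suc n) P → ∀ xs →
                         IsBooleanCombinationOfBalls (λ x → P (x Vector.∷ xs))
    booleanCombination {n} {P} (φ , p) xs = isCMinimal K (λ _ → mk⇔ id id) _
      (n ℕ.+ q , rename id φ , xs Vector.++ b , definition)
      where
      env : ∀ x {a} → Vector.head x ≈ a → ∀ i →
            (x Vector.++ (xs Vector.++ b)) i ≈ ((a Vector.∷ xs) Vector.++ b) i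
      env x eq zero    = eq
      env x eq (suc i) = reflexive (∷-++ _ xs b (suc i))
      definition : ∀ x w → Represents K (𝕂 ∷ []) x w →
        P (proj₁ w Vector.∷ xs) ⇔ (structure ⊨ rename id φ ⟨ x Vector.++ (xs Vector.++ b) ⟩)
      definition x (a , _) (eq , _) =
        ⇔-sym (⊨-rename structure φ id (env x eq)) ⇔-∘ p (a Vector.∷ xs)

-- Suprema of definable initial segments.

module CMinimal {ℓ : Level} (em : ExcludedMiddle ℓ) {𝓔 : Language ℓ}
  (K : ExpandedValuedField 𝓔) (K-Cminimal : IsCMinimalValuedField K)
  {q : ℕ} (b : Vector (ExpandedValuedField.Carrier K) q) where
  open ExpandedValuedField K hiding (zero)
  open ValuationPreorder em valuedField
  open AlgebraicallyClosed em valuedField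
    (IsCMinimalValuedField.isAlgebraicallyClosed K-Cminimal)
  open Definability K b
  open Equivalence using (to; from)
  open AbelianGroupProperties +-abelianGroup using (xyx⁻¹≈y)
  open GroupProperties +-group using (⁻¹-anti-homo-//)
  open CommutativeSemigroupProperties +-commutativeSemigroup using (interchange)
  open import Relation.Binary.Reasoning.Setoid setoid

  opaque
    definable-constant-on-circle : ∀ {n P} → Definable (ℕ.suc n) P → ∀ xs r →
      ∃[ L ] (∀ {x y} → x ~ r → y ~ r → Avoids r L x → Avoids r L y →
        P (x Vector.∷ xs) → P (y Vector.∷ xs))
    definable-constant-on-circle d xs r with booleanCombination K-Cminimal d xs
    ... | β , ⊆β , β⊆ with constant-on-circle r β
    ...   | L , const = L , λ x~r y~r avx avy p → β⊆ (const x~r y~r avx avy (⊆β p))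

    -- For a union of circles this amounts to o-minimality of the value group.
    definable-thresholds : ∀ {n P} → Definable (ℕ.suc n) P → ∀ xs →
      ∃[ L ] (∀ {x y} → x ≼ y → All (λ l → ¬ Between x y l) L →
        P (x Vector.∷ xs) ⇔ P (y Vector.∷ xs))
    definable-thresholds d xs with booleanCombination K-Cminimal d xs
    ... | β , ⊆β , β⊆ with thresholds β
    ...   | L , same = L , λ x≼y gap →
      mk⇔ (λ p → β⊆ (to (same x≼y gap) (⊆β p))) (λ p → β⊆ (from (same x≼y gap) (⊆β p)))

  -- Membership of `t` itself is left open, so initial segments with and without a largest value are
  -- treated alike. The supremum may be 0, that is, the value ∞.
  IsSup : (Carrier → Set ℓ) → Carrier → Set ℓ
  IsSup D t = ∀ z → (z ≺ t → D z) × (t ≺ z → ¬ D z)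

  -- By density, a point strictly between two suprema would lie both in `D` and outside it.
  IsSup-unique : ∀ {D s t} → IsSup D s → IsSup D t → s ~ t
  IsSup-unique sup-s sup-t = ¬¬-elim (distinct sup-t sup-s) , ¬¬-elim (distinct sup-s sup-t)
    where
    distinct : ∀ {D s t} → IsSup D s → IsSup D t → ¬ (s ≺ t)
    distinct sup-s sup-t s≺t with ≺-dense s≺t
    ... | m , s≺m , m≺t = proj₂ (sup-s m) s≺m (proj₁ (sup-t m) m≺t)

  -- A point l that is not the supremum can be dropped from the list, since a
  -- pair x ∈ D, y ∉ D around l can be replaced by one on one side of l.
  sup-exists : ∀ {D} → (∀ {x y} → x ≼ y → D y → D x) → ∀ {s u} → D s → ¬ D u →
    ∀ L → (∀ {x y} → D x → ¬ D y → Any (Between x y) L) → ∃[ t ] (IsSup D t)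
  sup-exists down Ds ¬Du [] boundary with boundary Ds ¬Du
  ... | ()
  sup-exists {D} down Ds ¬Du (l ∷ L) boundary with em {P = IsSup D l}
  ... | yes sup = l , sup
  ... | no ¬sup = sup-exists down Ds ¬Du L boundary′
    where
    drop : ∀ {x y} → ¬ Between x y l → Any (Between x y) (l ∷ L) → Any (Between x y) L
    drop ∉ (here p)  = contradiction p ∉
    drop ∉ (there p) = p
    boundary′ : ∀ {x y} → D x → ¬ D y → Any (Between x y) L
    boundary′ {x} {y} Dx ¬Dy with em {P = ∃[ z ] (l ≺ z × D z)} | em {P = ∃[ z ] (z ≺ l × ¬ D z)}
    ... | yes (z , l≺z , Dz) | _ with ≼-or-≻ x z
    ...   | inj₁ x≼z = Any.map (λ (p , p′) → ≼-trans x≼z p , p′)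
              (drop (λ (z≼l , _) → l≺z z≼l) (boundary Dz ¬Dy))
    ...   | inj₂ z≺x = drop (λ (x≼l , _) → l≺z (≼-trans (≺⇒≼ z≺x) x≼l)) (boundary Dx ¬Dy)
    boundary′ {x} {y} Dx ¬Dy | no _ | yes (z , z≺l , ¬Dz) with ≼-or-≻ z y
    ...   | inj₁ z≼y = Any.map (λ (p , p′) → p , ≼-trans p′ z≼y)
              (drop (λ (_ , l≼z) → z≺l l≼z) (boundary Dx ¬Dz))
    ...   | inj₂ y≺z = drop (λ (_ , l≼y) → z≺l (≼-trans l≼y (≺⇒≼ y≺z))) (boundary Dx ¬Dy)
    boundary′ Dx ¬Dy | no ∄above | no ∄below = contradiction
      (λ z → (λ z≺l → ¬¬-elim λ ¬Dz → ∄below (z , z≺l , ¬Dz)) , (λ l≺z Dz → ∄above (z , l≺z , Dz)))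
      ¬sup

  -- Between a point of the set and a point outside it there is a threshold, so the thresholds are
  -- the candidates for the supremum.
  definable-sup-exists : ∀ {n P} → Definable (ℕ.suc n) P → ∀ xs →
    (let D = λ z → P (z Vector.∷ xs)) →
    (∀ {x y} → x ≼ y → D y → D x) → ∀ {s u} → D s → ¬ D u → ∃[ t ] (IsSup D t)
  definable-sup-exists {P = P} d xs down Ds ¬Du with definable-thresholds d xs
  ... | L , same = sup-exists down Ds ¬Du L boundary
    where
    boundary : ∀ {x y} → P (x Vector.∷ xs) → ¬ P (y Vector.∷ xs) → Any (Between x y) L
    boundary {x} {y} Dx ¬Dy = ¬¬-elim λ none → ¬Dy
      (to (same (≺⇒≼ (λ y≼x → ¬Dy (down y≼x Dx))) (All.¬Any⇒All¬ L none)) Dx)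

  module InitialSegments (S : Carrier → Carrier → Set ℓ)
    (S-definable : Definable 2 (λ xs → S (xs 0F) (xs 1F)))
    {r} (r≉0 : r ≉ 0#)
    (S-class : ∀ {c c′ z} → c ~ r → r ≺ c - c′ → S c z → S c′ z) where

    private
      -- By `IsSup-unique` each centre in `M` contributes at most one supremum up to `~`.
      S-sups : ∀ M → ∃[ N ] (∀ {t} → Any (λ a → IsSup (S a) t) M → Any (t ~_) N)
      S-sups [] = [] , λ ()
      S-sups (a ∷ M) with S-sups M | em {P = ∃[ t ] (IsSup (S a) t)}
      ... | N , sups | yes (s , sup) = s ∷ N , λ
        { (here p) → here (IsSup-unique p sup) ; (there p) → there (sups p) }
      ... | N , sups | no ∄sup = N , λ
        { (here p) → contradiction (_ , p) ∄sup ; (there p) → sups p }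

      -- The circle is a variable `ρ`, so that the condition is definable over `b`; `r` is
      -- substituted afterwards.
      IsSomeSup : Carrier → Carrier → Set ℓ
      IsSomeSup t ρ = ∃[ c ] (c ~ ρ × IsSup (S c) t)

      IsSomeSup-definable : Definable 2 (λ xs → IsSomeSup (xs 0F) (xs 1F))
      IsSomeSup-definable = exᵈ ((varᵈ 0F ≼ᵈ varᵈ 2F ×ᵈ varᵈ 2F ≼ᵈ varᵈ 0F) ×ᵈ allᵈ
        ((¬ᵈ (varᵈ 2F ≼ᵈ varᵈ 0F) →ᵈ relationᵈ S S-definable 1F 0F) ×ᵈ
         (¬ᵈ (varᵈ 0F ≼ᵈ varᵈ 2F) →ᵈ ¬ᵈ relationᵈ S S-definable 1F 0F)))

      S-class-sup : ∀ {c a t} → c ~ r → r ≺ c - a → IsSup (S c) t → IsSup (S a) t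
      S-class-sup c~r p sup z = (λ z≺t → S-class c~r p (proj₁ (sup z) z≺t)) ,
        (λ t≺z Sa → proj₂ (sup z) t≺z (S-class (residue-class-~ c~r p) (minus-sym-≺ p) Sa))

    opaque
      -- If t were a supremum away from the thresholds of the set of suprema,
      -- then so would be every s near t.  But S c t has the same truth value
      -- for all c outside finitely many residue classes, so on one side of t
      -- only the finitely many other classes can contribute.
      finitely-many-sups : ∃[ L ] (∀ {c t} → c ~ r → IsSup (S c) t → Any (t ~_) L)
      finitely-many-sups with definable-thresholds IsSomeSup-definable (r Vector.∷ Vector.[])
      -- 0 is listed to cover the supremum ∞, which has no values above it.
      ... | L , same = 0# ∷ L , λ c~r sup → ¬¬-elim (isolated c~r sup)
        where
        isolated : ∀ {c t} → c ~ r → IsSup (S c) t → ¬ ¬ Any (t ~_) (0# ∷ L)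
        isolated {c} {t} c~r sup t∉L
          with definable-constant-on-circle {P = λ xs → S (xs 0F) (xs 1F)} S-definable (t Vector.∷ Vector.[]) r
        -- `M` gives the exceptional classes for the condition `S c t` on c, `N` the suprema they
        -- contribute, and `c₀` lies in none of these classes.
        ... | M , const with S-sups M | avoid r≉0 M
        ...   | N , sups | c₀ , c₀~r , avoids = two-sides (em {P = S c₀ t})
          where
          t≉0 : t ≉ 0#
          t≉0 t≈0 = t∉L (here (≈⇒~ t≈0))
          t≁L : All (λ l → ¬ (t ~ l)) L
          t≁L = All.tail (All.¬Any⇒All¬ (0# ∷ L) t∉L)
          exceptional : ∀ {c₁ s} → c₁ ~ r → IsSup (S c₁) s → ¬ Avoids r M c₁ → Any (s ~_) N
          exceptional c₁~r sup₁ ¬av =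
            sups (Any.map (λ p → S-class-sup c₁~r p sup₁) (¬avoids⇒residue-class ¬av))
          two-sides : Dec (S c₀ t) → ⊥
          -- The gap is free of `L`, so that `s` is again a supremum, and free of `N`, so that `s`
          -- does not come from an exceptional class. But a class outside `M` has `t` in its segment
          -- and cannot have its supremum below `t`.
          two-sides (yes Sc₀t) with gap-below t≉0 (L ++ N)
          ... | s , s≺t , gap with from (same (≺⇒≼ s≺t) no-threshold) (c , c~r , sup)
            where
            no-threshold : All (λ l → ¬ Between s t l) L
            no-threshold = All.zipWith (λ (∉ , t≁l) (s≼l , l≼t) →
              ∉ (s≼l , λ t≼l → t≁l (t≼l , l≼t))) (All.++⁻ˡ L gap , t≁L)
          ...   | c₁ , c₁~r , sup₁ = All.All¬⇒¬Any
            (All.map (λ ∉ (s≼n , n≼s) → ∉ (s≼n , ≼-≺-trans n≼s s≺t)) (All.++⁻ʳ L gap))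
            (exceptional c₁~r sup₁ λ avoids₁ →
              proj₂ (sup₁ t) s≺t (const c₀~r c₁~r avoids avoids₁ Sc₀t))
          -- Dually, a class outside `M` with supremum `s` above `t` would have `t` in its segment.
          two-sides (no ¬Sc₀t) with gap-above t≉0 (L ++ N)
          ... | s , t≺s , gap with to (same (≺⇒≼ t≺s) no-threshold) (c , c~r , sup)
            where
            no-threshold : All (λ l → ¬ Between t s l) L
            no-threshold = All.zipWith (λ (∉ , t≁l) (t≼l , l≼s) →
              ∉ ((λ l≼t → t≁l (t≼l , l≼t)) , l≼s)) (All.++⁻ˡ L gap , t≁L)
          ...   | c₁ , c₁~r , sup₁ = All.All¬⇒¬Any
            (All.map (λ ∉ (s≼n , n≼s) → ∉ (≺-≼-trans t≺s s≼n , n≼s)) (All.++⁻ʳ L gap))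
            (exceptional c₁~r sup₁ λ avoids₁ →
              ¬Sc₀t (const c₁~r c₀~r avoids₁ avoids (proj₁ (sup₁ t) t≺s)))

  -- Generic values on circles.

  module _ (g : Carrier → Carrier) (g≉0 : ∀ x → g x ≉ 0#)
    (≼g-definable : Definable 2 (λ xs → xs 0F ≼ g (xs 1F)))
    (g≼-definable : Definable 2 (λ xs → g (xs 1F) ≼ xs 0F)) where

    private
      ≼gᵈ : ∀ {n} i j → Definable n (λ xs → xs i ≼ g (xs j))
      ≼gᵈ = relationᵈ (λ x y → x ≼ g y) ≼g-definable

      g≼ᵈ : ∀ {n} i j → Definable n (λ xs → g (xs j) ≼ xs i)
      g≼ᵈ = relationᵈ (λ x y → g y ≼ x) g≼-definable

      -- Only comparisons of `g` with a variable are given, so a variable is interpolated between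
      -- the two values.
      g≼gᵈ : ∀ {n} i j → Definable n (λ xs → g (xs i) ≼ g (xs j))
      g≼gᵈ = relationᵈ (λ x y → g x ≼ g y)
        (exᵈ {P = λ xs z → g (xs 0F) ≼ z × z ≼ g (xs 1F)} (g≼ᵈ 0F 1F ×ᵈ ≼gᵈ 0F 2F) ≐ᵈ λ xs → mk⇔
          (λ p → g (xs 0F) , ≼-refl , p)
          (λ (z , p , q) → ≼-trans p q))

      _~ᵈ_ : ∀ {n} i j → Definable n (λ xs → xs i ~ xs j)
      i ~ᵈ j = varᵈ i ≼ᵈ varᵈ j ×ᵈ varᵈ j ≼ᵈ varᵈ i

      g~gᵈ : ∀ {n} i j → Definable n (λ xs → g (xs i) ~ g (xs j))
      g~gᵈ i j = g≼gᵈ i j ×ᵈ g≼gᵈ j i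

      g-comparisons-constant : ∀ r z → ∃[ M ] (∀ {x y} → x ~ r → y ~ r →
        Avoids r M x → Avoids r M y → (z ≼ g x → z ≼ g y) × (g x ≼ z → g y ≼ z))
      g-comparisons-constant r z
        with definable-constant-on-circle {P = λ xs → xs 1F ≼ g (xs 0F)} (≼gᵈ 1F 0F) (z Vector.∷ Vector.[]) r
           | definable-constant-on-circle {P = λ xs → g (xs 0F) ≼ xs 1F} (g≼ᵈ 1F 0F) (z Vector.∷ Vector.[]) r
      ... | M , const | M′ , const′ = M ++ M′ , λ x~r y~r avx avy →
        const x~r y~r (All.++⁻ˡ M avx) (All.++⁻ˡ M avy) ,
        const′ x~r y~r (All.++⁻ʳ M avx) (All.++⁻ʳ M avy)

      all-comparisons-constant : ∀ r L → ∃[ M ] (∀ {x y} → x ~ r → y ~ r →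
        Avoids r M x → Avoids r M y →
        All (λ z → (z ≼ g x → z ≼ g y) × (g x ≼ z → g y ≼ z)) L)
      all-comparisons-constant r [] = [] , λ _ _ _ _ → []
      all-comparisons-constant r (z ∷ L)
        with g-comparisons-constant r z | all-comparisons-constant r L
      ... | M , const | M′ , consts = M ++ M′ , λ x~r y~r avx avy →
        const x~r y~r (All.++⁻ˡ M avx) (All.++⁻ˡ M avy) ∷
        consts x~r y~r (All.++⁻ʳ M avx) (All.++⁻ʳ M avy)

      -- The downward closure and the set of lower bounds of the values of
      -- g on the residue class of c.
      SomeAbove EveryAbove : Carrier → Carrier → Set ℓ
      SomeAbove  c z = ∃[ y ] (c ≺ y - c × z ≼ g y)
      EveryAbove c z = ∀ y → c ≺ y - c → z ≼ g y

      SomeAbove-definable : Definable 2 (λ xs → SomeAbove (xs 0F) (xs 1F))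
      SomeAbove-definable = exᵈ (¬ᵈ (varᵈ 0F -ᵈ varᵈ 1F ≼ᵈ varᵈ 1F) ×ᵈ ≼gᵈ 2F 0F)

      EveryAbove-definable : Definable 2 (λ xs → EveryAbove (xs 0F) (xs 1F))
      EveryAbove-definable = allᵈ (¬ᵈ (varᵈ 0F -ᵈ varᵈ 1F ≼ᵈ varᵈ 1F) →ᵈ ≼gᵈ 2F 0F)

      -- In `SomeAbove` and `EveryAbove` the point `c` serves both as centre and, by its value, as
      -- radius; both have to be exchanged for `c′`.
      same-class : ∀ {r c c′ y} → c ~ r → r ≺ c - c′ → c ≺ y - c → c′ ≺ y - c′
      same-class c~r p q = ≼-≺-trans
        (≼-trans (proj₁ (residue-class-~ c~r p)) (proj₂ c~r))
        (minus-trans-≺ q (≼-≺-trans (proj₁ c~r) p))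

      same-class⁻ : ∀ {r c c′ y} → c ~ r → r ≺ c - c′ → c′ ≺ y - c′ → c ≺ y - c
      same-class⁻ c~r p = same-class (residue-class-~ c~r p) (minus-sym-≺ p)

      self-class : ∀ {r c} → r ≉ 0# → c ~ r → c ≺ c - c
      self-class {r} {c} r≉0 c~r p = ≼-≉0 (proj₁ c~r) r≉0
        (0≼⇒≈0 (≼-trans (≼-reflexive (sym (-‿inverseʳ c))) p))

      -- The point `x` only supplies the value; it may itself lie in an exceptional class.
      GenericallyConstant : Carrier → Carrier → Set ℓ
      GenericallyConstant r x = ∃[ M ] (∀ {y} → y ~ r → Avoids r M y → g y ~ g x)

      opaque
        -- Let y and then c be in general position.  If g c < g y, then g < g y
        -- on the residue class of c, and the supremum t of g there is one of
        -- finitely many values.  As g c ≤ t ≤ g y and g compares with these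
        -- values in the same way at c and at y, g y = t, and t is the generic
        -- value.  If g c > g y, argue with the infimum.
        some-generic-value : ∀ {r} → r ≉ 0# → ∃[ x ] (x ~ r × GenericallyConstant r x)
        some-generic-value {r} r≉0
          with InitialSegments.finitely-many-sups SomeAbove SomeAbove-definable r≉0
                 (λ c~r p (y , q , h) → y , same-class c~r p q , h)
             | InitialSegments.finitely-many-sups EveryAbove EveryAbove-definable r≉0
                 (λ c~r p h y q → h y (same-class⁻ c~r p q))
        ... | L , suprema | L′ , infima with all-comparisons-constant r (L ++ L′)
        ... | M , const with avoid r≉0 M
        -- `N` depends on `g y`, which is why `c` is chosen after `y` and has to avoid both lists.
        ... | y , y~r , avy with g-comparisons-constant r (g y)
        ... | N , constN with avoid r≉0 (M ++ N)
        ... | c , c~r , avc = y , y~r , cases (≼-or-≻ (g y) (g c)) (≼-or-≻ (g c) (g y))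
          where
          avcM : Avoids r M c
          avcM = All.++⁻ˡ M avc
          avcN : Avoids r N c
          avcN = All.++⁻ʳ M avc

          class-avoids : ∀ {x} → c ≺ x - c → x ~ r × Avoids r N x
          class-avoids p =
            let p′ = minus-sym-≺ (≼-≺-trans (proj₂ c~r) p)
            in residue-class-~ c~r p′ , avoids-residue-class p′ avcN

          value-in-list : ∀ {t} → g y ~ t → Any (t ~_) (L ++ L′) →
            ∀ {x} → x ~ r → Avoids r M x → g x ~ g y
          value-in-list δ~t t∈L x~r avx
            with All.lookupAny (const y~r x~r avy avx) t∈L
          ... | (lower , upper) , t~l =
              let δ~l = ~-trans δ~t t~l in
              ≼-trans (upper (proj₁ δ~l)) (proj₂ δ~l) ,
              ≼-trans (proj₁ δ~l) (lower (proj₂ δ~l))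

          c-to-y : ∀ {t} → Any (t ~_) (L ++ L′) → (t ≼ g c → t ≼ g y) × (g c ≼ t → g y ≼ t)
          c-to-y t∈L with All.lookupAny (const c~r y~r avcM avy) t∈L
          ... | (lower , upper) , t~l =
            (λ t≼gc → ≼-trans (proj₁ t~l) (lower (≼-trans (proj₂ t~l) t≼gc))) ,
            (λ gc≼t → ≼-trans (upper (≼-trans gc≼t (proj₁ t~l))) (proj₂ t~l))

          cases : g y ≼ g c ⊎ g c ≺ g y → g c ≼ g y ⊎ g y ≺ g c → GenericallyConstant r y
          -- If g c and g y have the same value, the comparisons with `g y` outside `N` already show
          -- that it is the generic value.
          cases (inj₁ gy≼gc) (inj₁ gc≼gy) = N , λ x~r avx →
            proj₂ (constN c~r x~r avcN avx) gc≼gy , proj₁ (constN c~r x~r avcN avx) gy≼gc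
          cases (inj₂ gc≺gy) _
            with definable-sup-exists {P = λ xs → SomeAbove (xs 1F) (xs 0F)}
                   (relationᵈ SomeAbove SomeAbove-definable 1F 0F) (c Vector.∷ Vector.[])
                   (λ p (x , q , h) → x , q , ≼-trans p h)
                   {s = g c} {u = g y}
                   (c , self-class r≉0 c~r , ≼-refl)
                   (λ (x , q , h) → let (x~r , avx) = class-avoids q in
                     gc≺gy (proj₁ (constN x~r c~r avx avcN) h))
          ... | t , sup = M , value-in-list (gy≼t , t≼gy) t∈L
            where
            t∈L : Any (t ~_) (L ++ L′)
            t∈L = Any.++⁺ˡ (suprema c~r sup)
            t≼gy : t ≼ g y
            t≼gy = ¬¬-elim λ gy≺t → let (x , q , h) = proj₁ (sup (g y)) gy≺t
                                        (x~r , avx) = class-avoids q in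
              gc≺gy (proj₁ (constN x~r c~r avx avcN) h)
            gy≼t : g y ≼ t
            gy≼t = proj₂ (c-to-y t∈L)
              (¬¬-elim λ t≺gc → proj₂ (sup (g c)) t≺gc (c , self-class r≉0 c~r , ≼-refl))
          -- As g c has finite value, there is a `u` above it, which is not a lower bound of g on
          -- the class of `c`.
          cases (inj₁ _) (inj₂ gy≺gc) with above (g≉0 c)
          ... | u , gc≺u , _
            with definable-sup-exists {P = λ xs → EveryAbove (xs 1F) (xs 0F)}
                   (relationᵈ EveryAbove EveryAbove-definable 1F 0F) (c Vector.∷ Vector.[])
                   (λ p h x q → ≼-trans p (h x q))
                   {s = g y} {u = u} gy-below
                   (λ h → gc≺u (h c (self-class r≉0 c~r)))
            where
            gy-below : EveryAbove c (g y)
            gy-below x q = ¬¬-elim λ gx≺gy → let (x~r , avx) = class-avoids q in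
              gy≺gc (proj₂ (constN x~r c~r avx avcN) (≺⇒≼ gx≺gy))
          ... | t , sup = M , value-in-list (gy≼t , t≼gy) t∈L
            where
            t∈L : Any (t ~_) (L ++ L′)
            t∈L = Any.++⁺ʳ L (infima c~r sup)
            gy≼t : g y ≼ t
            gy≼t = ¬¬-elim λ t≺gy → proj₂ (sup (g y)) t≺gy λ x q →
              ¬¬-elim λ gx≺gy → let (x~r , avx) = class-avoids q in
              gy≺gc (proj₂ (constN x~r c~r avx avcN) (≺⇒≼ gx≺gy))
            t≼gc : t ≼ g c
            -- `t` itself need not be a lower bound, but every `m` below it is.
            t≼gc = ¬¬-elim λ gc≺t → let (m , gc≺m , m≺t) = ≺-dense gc≺t in
              gc≺m (proj₁ (sup m) m≺t c (self-class r≉0 c~r))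
            t≼gy : t ≼ g y
            t≼gy = proj₁ (c-to-y t∈L) t≼gc

      -- The points of the circle of x at which g takes the value g x fill all
      -- but finitely many residue classes (rather than lie in finitely many)
      -- iff their differences reach every residue class of the closed ball
      -- around 0 of radius v x.
      Generic : Carrier → Set ℓ
      Generic x = ∀ u → x ≼ u → ∃[ a ] ∃[ a′ ]
        ((a ~ x × g a ~ g x) × (a′ ~ x × g a′ ~ g x) × x ≺ (a′ - a) - u)

      Generic-definable : Definable 1 (λ xs → Generic (xs 0F))
      Generic-definable = allᵈ (varᵈ 1F ≼ᵈ varᵈ 0F →ᵈ exᵈ (exᵈ
        ((1F ~ᵈ 3F ×ᵈ g~gᵈ 1F 3F) ×ᵈ (0F ~ᵈ 3F ×ᵈ g~gᵈ 0F 3F) ×ᵈ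
         ¬ᵈ ((varᵈ 0F -ᵈ varᵈ 1F) -ᵈ varᵈ 2F ≼ᵈ varᵈ 3F))))

      opaque
        generic-exists : ∀ {r} → r ≉ 0# → ∃[ x ] (x ~ r × Generic x)
        generic-exists {r} r≉0 with some-generic-value r≉0
        ... | x , x~r , M , const = x , x~r , generic
          where
          generic : Generic x
          -- The centres shifted by `u` make a + u avoid `M` as well, and the shifted 0 keeps it on
          -- the circle. The difference of a + u and a is exactly u.
          generic u x≼u with avoid r≉0 (M ++ map (_- u) (0# ∷ M))
          ... | a , a~r , av = a , a + u ,
            (~-trans a~r (~-sym x~r) , const a~r (All.++⁻ˡ M av)) ,
            (~-trans a+u~r (~-sym x~r) , const a+u~r (All.tail av+u)) ,
            (λ p → ≼-≉0 (proj₁ x~r) r≉0 (0≼⇒≈0 (≼-trans (≼-reflexive (sym (begin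
              ((a + u) - a) - u ≈⟨ +-congʳ (xyx⁻¹≈y a u) ⟩
              u - u             ≈⟨ -‿inverseʳ u ⟩
              0#                ∎))) p)))
            where
            minus-minus : ∀ m → a - (m - u) ≈ (a + u) - m
            minus-minus m = begin
              a - (m - u)   ≈⟨ +-congˡ (⁻¹-anti-homo-// m u) ⟩
              a + (u - m)   ≈⟨ +-assoc a u (- m) ⟨
              (a + u) - m   ∎
            av+u : Avoids r (0# ∷ M) (a + u)
            av+u = All.map (λ {m} p → ≼-trans (≼-reflexive (sym (minus-minus m))) p)
              (All.map⁻ (All.++⁻ʳ M av))
            a+u~r : a + u ~ r
            a+u~r = ≼-trans (≼-reflexive (sym (minus-0 (a + u)))) (All.head av+u)
                  , +-≼ (proj₂ a~r) (≼-trans (proj₂ x~r) x≼u)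

      -- Otherwise the points of the circle where g takes the value of g x lie in the classes of
      -- `M`, so their differences lie in the classes of the differences from `M`. A `u` on the
      -- circle that avoids these finitely many classes contradicts `Generic`.
      Generic⇒GenericallyConstant : ∀ {x} → x ≉ 0# → Generic x → GenericallyConstant x x
      Generic⇒GenericallyConstant {x} x≉0 generic
        with definable-constant-on-circle {P = λ xs → g (xs 0F) ~ g (xs 1F)} (g~gᵈ 0F 1F) (x Vector.∷ Vector.[]) x
      ... | M , const = M , λ y~x avy → ¬¬-elim (differences y~x avy)
        where
        differences : ∀ {y} → y ~ x → Avoids x M y → ¬ ¬ (g y ~ g x)
        differences {y} y~x avy gy≁gx with avoid x≉0 (cartesianProductWith _-_ M M)
        ... | u , (u≼x , x≼u) , avu with generic u x≼u
        ... | a , a′ , (a~x , ga~gx) , (a′~x , ga′~gx) , x≺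
          with find (class a~x ga~gx) | find (class a′~x ga′~gx)
          where
          class : ∀ {z} → z ~ x → g z ~ g x → Any (λ m → x ≺ z - m) M
          class z~x gz~gx = ¬avoids⇒residue-class λ avz → gy≁gx (const z~x y~x avz avy gz~gx)
        ... | m , m∈M , x≺a-m | m′ , m′∈M , x≺a′-m′ =
          minus-trans-≺ (minus-sym-≺ x≺) near
            (All.lookup avu (∈-cartesianProductWith⁺ _-_ m′∈M m∈M))
          where
          near : x ≺ (a′ - a) - (m′ - m)
          near = ≺-≼-trans (+-≺ x≺a′-m′ (minus-sym-≺ x≺a-m)) (≼-reflexive (begin
            (a′ - m′) + (m - a)   ≈⟨ +-congˡ (+-comm m (- a)) ⟩
            (a′ - m′) + (- a + m) ≈⟨ interchange a′ (- m′) (- a) m ⟩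
            (a′ - a) + (- m′ + m) ≈⟨ +-congˡ (+-comm (- m′) m) ⟩
            (a′ - a) + (m - m′)   ≈⟨ +-congˡ (⁻¹-anti-homo-// m′ m) ⟨
            (a′ - a) - (m′ - m)   ∎))

    opaque
      eventually-factorizes : ∃[ r ] (r ≉ 0# ×
        (∀ {x y} → x ≺ r → x ~ y → g x ~ g y))
      eventually-factorizes with definable-thresholds {P = λ xs → Generic (xs 0F)} Generic-definable Vector.[]
      -- Below all thresholds `same` applies to any two points of one circle, so a single generic
      -- point makes the whole circle generic.
      ... | L , same with lower-bound L
      ... | r , r≉0 , r≼L = r , r≉0 , λ {x} {y} x≺r x~y →
        let y≺r = ≼-≺-trans (proj₂ x~y) x≺r
            M , const = Generic⇒GenericallyConstant (≺⇒≉0 x≺r) (generic x≺r)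
            M′ , const′ = Generic⇒GenericallyConstant (≺⇒≉0 y≺r) (generic y≺r)
            -- At `z`, outside the exceptional classes of both points, g takes the value of g x as
            -- well as that of g y.
            z , z~x , avoids = avoid (≺⇒≉0 x≺r) (M ++ M′)
        in ~-trans
          (~-sym (const z~x (All.++⁻ˡ M avoids)))
          (const′ (~-trans z~x x~y) (All.map (λ p → ≼-trans p (proj₁ x~y)) (All.++⁻ʳ M avoids)))
        where
        generic : ∀ {x} → x ≺ r → Generic x
        generic x≺r with generic-exists (≺⇒≉0 x≺r)
        ... | x₀ , (x₀≼x , _) , gen = to (same x₀≼x (All.map (λ r≼l (_ , l≼x) →
          x≺r (≼-trans r≼l l≼x)) r≼L)) gen

-- The induced family on the value group.

module _ {ℓ : Level} {𝓔 : Language ℓ} (K : ExpandedValuedField 𝓔) where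
  open ExpandedValuedField K

  represent : ∀ s (w : Point K s) → ∃[ x ] (Represents K s x w)
  represent []      w       = Vector.[] , tt
  represent (𝕂 ∷ s) (a , w) with represent s w
  ... | x , rep = a Vector.∷ x , refl , rep
  represent (𝚪 ∷ s) (γ , w) with v-surjective γ | represent s w
  ... | a , va≈γ | x , rep = a Vector.∷ x , va≈γ , rep

module Factorization {ℓ : Level} (em : ExcludedMiddle ℓ) {𝓔 : Language ℓ}
  (K : ExpandedValuedField 𝓔) (K-Cminimal : IsCMinimalValuedField K)
  {s : List Sort} (W : DefinableSet K s) (F : DefinableFamilyOfFunctions K W 𝕂) where
  open ExpandedValuedField K hiding (zero)
  open DefinableSet W using (member)
  open DefinableFamilyOfFunctions F
  open ValuationPreorder em valuedField
  open Equivalence using (to; from)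

  p : ℕ
  p = proj₁ graphIsDefinable

  Φ : Formula (𝓛div⊎ 𝓔) (ℕ.suc (ℕ.suc (length s)) ℕ.+ p)
  Φ = proj₁ (proj₂ graphIsDefinable)

  parameters : Vector Carrier p
  parameters = proj₁ (proj₂ (proj₂ graphIsDefinable))

  Graph : Point K s → Carrier → Carrier → Set ℓ
  Graph w y x = Σ[ p ∈ x ∈ X w ] (f w x p ≈ y)

  Graph⇔⊨Φ : ∀ xs {y x w} → Represents K (𝕂 ∷ 𝕂 ∷ s) xs (y , x , w) →
    Graph w y x ⇔ (structure ⊨ Φ ⟨ xs Vector.++ parameters ⟩)
  Graph⇔⊨Φ xs {y} {x} {w} = proj₂ (proj₂ (proj₂ graphIsDefinable)) xs (y , x , w)

  module _ (f≉0 : ∀ w x (x∈X : x ∈ X w) → f w x x∈X ≉ 0#) where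

    module Fibre (w : Point K s) where

      -- A representative of `w` joins the parameters, so that the results for a single function
      -- apply to one fibre at a time.
      coordinates : Vector Carrier (length s)
      coordinates = proj₁ (represent K s w)

      open Definability K (coordinates Vector.++ parameters)

      Graph-definable : Definable 2 (λ xs → Graph w (xs 0F) (xs 1F))
      Graph-definable = rename id Φ , λ xs →
        ⇔-sym (⊨-rename structure Φ id (env xs)) ⇔-∘
        Graph⇔⊨Φ (xs 0F Vector.∷ xs 1F Vector.∷ coordinates) (refl , refl , proj₂ (represent K s w))
        where
        env : ∀ (xs : Vector Carrier 2) i →
          (xs Vector.++ (coordinates Vector.++ parameters)) i ≈
          ((xs 0F Vector.∷ xs 1F Vector.∷ coordinates) Vector.++ parameters) i
        env xs zero          = refl
        env xs (suc zero)    = refl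
        env xs (suc (suc i)) = reflexive (≡.trans
          (∷-++ (xs 1F) coordinates parameters (suc i))
          (∷-++ (xs 0F) (xs 1F Vector.∷ coordinates) parameters (suc (suc i))))

      -- f w extended by 1 outside its domain.
      g : Carrier → Carrier
      g x with em {P = x ∈ X w}
      ... | yes x∈X = f w x x∈X
      ... | no _    = 1#

      g≈f : ∀ {x} (x∈X : x ∈ X w) → g x ≈ f w x x∈X
      g≈f {x} x∈X with em {P = x ∈ X w}
      ... | yes x∈X′ = PartialFunction.fn-cong (fibre w) refl x∈X′ x∈X
      ... | no x∉X   = contradiction x∈X x∉X

      g≉0 : ∀ x → g x ≉ 0#
      g≉0 x with em {P = x ∈ X w}
      ... | yes x∈X = f≉0 w x x∈X
      ... | no _    = 1≉0

      -- Conditions on `g` are expressed through the graph of f; the second disjunct accounts for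
      -- the default value 1.
      g-graph : ∀ (P : Carrier → Set ℓ) → (∀ {y z} → y ≈ z → P y → P z) → ∀ x →
        P (g x) ⇔ ((∃[ y ] (Graph w y x × P y)) ⊎ (¬ (∃[ y ] Graph w y x) × P 1#))
      g-graph P resp x with em {P = x ∈ X w}
      ... | yes x∈X = mk⇔ (λ q → inj₁ (_ , (x∈X , refl) , q))
        [ (λ (y , (x∈X′ , eq) , q) →
             resp (trans (sym eq) (PartialFunction.fn-cong (fibre w) refl x∈X′ x∈X)) q)
        , (λ (∄ , _) → contradiction (_ , x∈X , refl) ∄) ]′
      ... | no x∉X = mk⇔ (λ q → inj₂ ((λ (_ , x∈X , _) → x∉X x∈X) , q))
        [ (λ (_ , (x∈X , _) , _) → contradiction x∈X x∉X) , proj₂ ]′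

      Graphᵈ : ∀ {n} i j → Definable n (λ xs → Graph w (xs i) (xs j))
      Graphᵈ = relationᵈ (Graph w) Graph-definable

      ≼g-definable : Definable 2 (λ xs → xs 0F ≼ g (xs 1F))
      ≼g-definable =
        exᵈ (Graphᵈ 0F 2F ×ᵈ varᵈ 1F ≼ᵈ varᵈ 0F) ⊎ᵈ ¬ᵈ exᵈ (Graphᵈ 0F 2F) ×ᵈ varᵈ 0F ≼ᵈ oneᵈ
        ≐ᵈ λ xs → g-graph (xs 0F ≼_) (λ eq q → ≼-trans q (≼-reflexive eq)) (xs 1F)

      g≼-definable : Definable 2 (λ xs → g (xs 1F) ≼ xs 0F)
      g≼-definable =
        exᵈ (Graphᵈ 0F 2F ×ᵈ varᵈ 0F ≼ᵈ varᵈ 1F) ⊎ᵈ ¬ᵈ exᵈ (Graphᵈ 0F 2F) ×ᵈ oneᵈ ≼ᵈ varᵈ 0F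
        ≐ᵈ λ xs → g-graph (_≼ xs 0F) (λ eq q → ≼-trans (≼-reflexive (sym eq)) q) (xs 1F)

      opaque
        f-eventually-factorizes : ∃[ r ] (r ≉ 0# × (∀ {x y} → x ≺ r → x ~ y →
          ∀ (x∈X : x ∈ X w) (y∈X : y ∈ X w) → f w x x∈X ~ f w y y∈X))
        f-eventually-factorizes
          with CMinimal.eventually-factorizes em K K-Cminimal (coordinates Vector.++ parameters)
                 g g≉0 ≼g-definable g≼-definable
        ... | r , r≉0 , factorizes = r , r≉0 , λ x≺r x~y x∈X y∈X →
          ~-trans (~-sym (≈⇒~ (g≈f x∈X))) (~-trans (factorizes x≺r x~y) (≈⇒~ (g≈f y∈X)))

    -- The whole circle has to lie in `X w` with one common value of f. This value is unique because
    -- circles are nonempty, so it can be stored in the witness.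
    HDom : Point K s → Γ.Carrier → Set ℓ
    HDom w γ = Σ[ δ ∈ Γ.Carrier ]
      (∀ x → v x ≈⁺ [ γ ] → Σ[ x∈X ∈ x ∈ X w ] (v (f w x x∈X) ≈⁺ [ δ ]))

    FactorsAt : Point K s → Carrier → Set ℓ
    FactorsAt w x = Σ[ γ ∈ Γ.Carrier ] Σ[ d ∈ HDom w γ ] (v x ≈⁺ [ γ ]) ×
      (∀ (x∈X : x ∈ X w) → v (f w x x∈X) ≈⁺ [ proj₁ d ])

    open ≤⁺.Eq using () renaming (sym to ≈⁺-sym; trans to ≈⁺-trans)

    h : Point K s → PartialFunction Γ.setoid Γ.setoid
    h w = record
      { Dom      = HDom w
      ; Dom-resp = λ γ≈γ′ (δ , q) → δ , λ x vx → q x (≈⁺-trans vx Γ.[ Γ.sym γ≈γ′ ]≈)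
      ; fn       = λ _ → proj₁
      ; fn-cong  = λ {γ} γ≈γ′ (δ , q) (δ′ , q′) →
          let x , vx = v-surjective γ
              x∈X , vf = q x vx
              x∈X′ , vf′ = q′ x (≈⁺-trans vx Γ.[ γ≈γ′ ]≈)
          in [≈]-injective (≈⁺-trans (≈⁺-sym vf) (≈⁺-trans
               (v-cong (PartialFunction.fn-cong (fibre w) refl x∈X x∈X′)) vf′))
      }

    HGraph : Point K (𝚪 ∷ 𝚪 ∷ s) → Set ℓ
    HGraph (δ , γ , w) = Σ[ d ∈ HDom w γ ] (proj₁ d Γ.≈ δ)

    private
      open Definability K parameters

      -- Selects (y , x , w) from (y , x , δ , γ , w).
      σ : ∀ {n} → Fin (2 ℕ.+ n) → Fin (4 ℕ.+ n)
      σ zero          = zero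
      σ (suc zero)    = suc zero
      σ (suc (suc i)) = suc (suc (suc (suc i)))

      -- The graph of `h` in terms of representatives. The coordinates of w remain variables, so one
      -- formula serves the whole family.
      HΦ : Vector Carrier (2 ℕ.+ length s) → Set ℓ
      HΦ xs = ∀ x → x ~ xs 1F → ∃[ y ]
        ((structure ⊨ Φ ⟨ ((y Vector.∷ x Vector.∷ xs) ∘ σ) Vector.++ parameters ⟩) × y ~ xs 0F)

      HΦ-definable : Definable (2 ℕ.+ length s) HΦ
      HΦ-definable = allᵛ ((varᵈ 0F ≼ᵈ varᵈ 2F ×ᵈ varᵈ 2F ≼ᵈ varᵈ 0F) →ᵈ
        exᵛ (reindex (Φ , λ _ → mk⇔ id id) σ ×ᵈ (varᵈ 0F ≼ᵈ varᵈ 2F ×ᵈ varᵈ 2F ≼ᵈ varᵈ 0F)))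

      HGraph⇔HΦ : ∀ xs w → Represents K (𝚪 ∷ 𝚪 ∷ s) xs w → HGraph w ⇔ HΦ xs
      HGraph⇔HΦ xs (δ , γ , w) (vδ , vγ , rep) = mk⇔ HGraph⇒HΦ HΦ⇒HGraph
        where
        HGraph⇒HΦ : HGraph (δ , γ , w) → HΦ xs
        HGraph⇒HΦ ((δ′ , q) , δ′≈δ) x x~γ with q x (≈⁺-trans (~⇒v x~γ) vγ)
        ... | x∈X , vf = f w x x∈X , to (Graph⇔⊨Φ _ (refl , refl , rep)) (x∈X , refl) ,
          v⇒~ (≈⁺-trans vf (≈⁺-trans Γ.[ δ′≈δ ]≈ (≈⁺-sym vδ)))
        HΦ⇒HGraph : HΦ xs → HGraph (δ , γ , w)
        HΦ⇒HGraph q = (δ , value) , Γ.refl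
          where
          value : ∀ x → v x ≈⁺ [ γ ] → Σ[ x∈X ∈ x ∈ X w ] (v (f w x x∈X) ≈⁺ [ δ ])
          value x vx with q x (v⇒~ (≈⁺-trans vx (≈⁺-sym vγ)))
          ... | y , ⊨Φ , y~δ with from (Graph⇔⊨Φ _ (refl , refl , rep)) ⊨Φ
          ...   | x∈X , f≈y = x∈X , ≈⁺-trans (v-cong f≈y) (≈⁺-trans (~⇒v y~δ) vδ)

      HDom⇔HΦ : ∀ xs w → Represents K (𝚪 ∷ s) xs w →
        HDom (proj₂ w) (proj₁ w) ⇔ (∃[ z ] HΦ (z Vector.∷ xs))
      HDom⇔HΦ xs (γ , w) (vγ , rep) = mk⇔ HDom⇒HΦ HΦ⇒HDom
        where
        HDom⇒HΦ : HDom w γ → ∃[ z ] HΦ (z Vector.∷ xs)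
        HDom⇒HΦ d with v-surjective (proj₁ d)
        ... | z , vz = z , to (HGraph⇔HΦ (z Vector.∷ xs) (proj₁ d , γ , w) (vz , vγ , rep)) (d , Γ.refl)
        HΦ⇒HDom : ∃[ z ] HΦ (z Vector.∷ xs) → HDom w γ
        -- A witness in K might have value ∞. Evaluating at the representative `xs 0F` of the circle
        -- gives `z` the value of some value of f, which is finite because f has no zeros.
        HΦ⇒HDom (z , q) with q (xs 0F) ~-refl
        ... | y , ⊨Φ , y~z with from (Graph⇔⊨Φ _ (refl , refl , rep)) ⊨Φ
        ...   | x∈X , f≈y with finite-value (≼-≉0 (proj₂ y~z) λ y≈0 → f≉0 w _ x∈X (trans f≈y y≈0))
        ...     | δ , vz = proj₁ (from (HGraph⇔HΦ (z Vector.∷ xs) (δ , γ , w) (vz , vγ , rep)) q)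

    module _ (atInfinity : IsDefinedAtInfinity K F) where

      opaque
        -- `r` lies below both the radius beyond which `f w` is defined and the one beyond which its
        -- value is constant on circles.
        h-near-infinity : ∀ {w} → w ∈ member → ∃[ r ] (r ≉ 0# × (∀ {x} → x ≺ r → FactorsAt w x))
        h-near-infinity {w} w∈W
          with atInfinity w w∈W | Fibre.f-eventually-factorizes w
        ... | γ₁ , ⊆X | r₂ , _ , factorizes with v-surjective γ₁
        ... | r₁ , vr₁ with lower-bound (r₁ ∷ r₂ ∷ [])
        ... | r , r≉0 , r≼r₁ ∷ r≼r₂ ∷ [] = r , r≉0 , near
          where
          in-X : ∀ {x} → x ≺ r → x ∈ X w
          in-X {x} x≺r = ⊆X x λ γ₁≤ → ≺-≼-trans x≺r r≼r₁
            (≼-trans (≤⁺.trans (≤⁺.reflexive vr₁) γ₁≤) (≼-reflexive (minus-0 x)))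
          near : ∀ {x} → x ≺ r → FactorsAt w x
          near {x} x≺r with finite-value (≺⇒≉0 x≺r) | finite-value (f≉0 w x (in-X x≺r))
          ... | γ , vx | δ , vf = γ , (δ , value) , vx , λ x∈X →
            ≈⁺-trans (v-cong (PartialFunction.fn-cong (fibre w) refl x∈X (in-X x≺r))) vf
            where
            value : ∀ y → v y ≈⁺ [ γ ] → Σ[ y∈X ∈ y ∈ X w ] (v (f w y y∈X) ≈⁺ [ δ ])
            value y vy = in-X y≺r , ≈⁺-trans
              (~⇒v (factorizes (≺-≼-trans y≺r r≼r₂) y~x (in-X y≺r) (in-X x≺r))) vf
              where
              y~x : y ~ x
              y~x = v⇒~ (≈⁺-trans vy (≈⁺-sym vx))
              y≺r : y ≺ r
              y≺r = ≼-≺-trans (proj₁ y~x) x≺r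

      H : DefinableFamilyOfFunctions K W 𝚪
      H = record
        { fibre             = h
        ; X⊆W×σ             = λ {w} {γ} (δ , q) →
            let x , vx = v-surjective γ in X⊆W×σ (proj₁ (q x vx))
        -- Any point near infinity has its value in the domain of `h w`.
        ; projection        = λ w∈W →
            let r , r≉0 , near = h-near-infinity w∈W
                x , x≺r = below r≉0
                γ , d , _ = near x≺r
            in γ , d
        ; domainIsDefinable =
            let φ , eq = exᵛ HΦ-definable in
            p , φ , parameters , λ xs w rep → eq xs ⇔-∘ HDom⇔HΦ xs w rep
        ; graphIsDefinable  =
            let φ , eq = HΦ-definable in
            p , φ , parameters , λ xs w rep → eq xs ⇔-∘ HGraph⇔HΦ xs w rep
        }

      F-factorizes : ∀ w → w ∈ member → FactorizesAtInfinity K (fibre w) (h w)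
      F-factorizes w w∈W with h-near-infinity w∈W
      ... | r , r≉0 , near with finite-value r≉0
      ... | γ₀ , vr = γ₀ , λ x x∈X x∉ball →
        let γ , d , vx , vf = near λ r≼x → x∉ball
              (≤⁺.trans (≤⁺.reflexive (≈⁺-sym vr)) (≼-trans r≼x (≼-reflexive (sym (minus-0 x)))))
        in γ , d , vx , vf x∈X

theorem3p7 :
    (∀ {a} → ExcludedMiddle a) →
    ∀ {ℓ : Level} {𝓔 : Language ℓ} (K : ExpandedValuedField 𝓔) →
    IsCMinimalValuedField K →
    let open ExpandedValuedField K
        open DefinableSet
        open DefinableFamilyOfFunctions in
    ∀ {s : List Sort} (W : DefinableSet K s)
    (F : DefinableFamilyOfFunctions K W 𝕂) →
    (∀ w x (x∈X : x ∈ X F w) → f F w x x∈X ≉ 0#) →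
    IsDefinedAtInfinity K F →
    Σ[ H ∈ DefinableFamilyOfFunctions K W 𝚪 ]
      (∀ w → w ∈ member W → FactorizesAtInfinity K (fibre F w) (fibre H w))
theorem3p7 em K K-Cminimal W F f≉0 atInfinity =
  H f≉0 atInfinity , F-factorizes f≉0 atInfinity
  where open Factorization em K K-Cminimal W F
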